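{- Consider the cop and random killer game on a connected graph $G$ with maximum degree $d$. The bound that the cop can win with probability at least $\frac{\sqrt d}{1+\sqrt d}$ after learning the killer's distribution is tight only on the $(d+1)$-vertex star, where the killer takes the center with probability $\frac{1}{1+\sqrt d}$ and each of the other vertices with equal probabilities.
   Context: The $(d+1)$-vertex star consists of a center vertex adjacent to $d$ other vertices, with no other edges. The cop and random killer game on a connected graph $G$: the cop chooses any starting vertex of $G$, and the random killer chooses a probability distribution $\{p_v\}_{v\in V(G)}$ on the vertices of $G$, knowing the cop's starting vertex before choosing the distribution. In the version considered here, the cop learns this distribution after choosing her starting vertex and before her first move. On odd turns, the cop either moves to an adjacent vertex or stays at her current vertex. On even turns, the random killer hops to a vertex using his probability distribution. The random killer wins if he lands on the cop's current vertex, and the cop wins if she lands on the killer's current vertex; the game may also end in a stalemate, in which nobody ever wins. The cop plays to maximize her probability of winning, and the killer plays to maximize his. -}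

module Defs where

open import Algebra.Bundles using (CommutativeRing)
open import Algebra.Structures using (IsCommutativeRing)
open import Data.Fin.Base using (Fin)
open import Data.Fin.Properties using (_≟_)
open import Data.List.Base using (List; []; _∷_; length; filter; allFin)
open import Data.Nat.Base as ℕ using (ℕ; zero; suc)
open import Data.Product.Base using (Σ; ∃; _×_)
open import Data.Sum.Base using (_⊎_)
open import Level using (Level; 0ℓ) renaming (suc to lsuc)
open import Relation.Binary.Core using (Rel)
open import Relation.Binary.Definitions using (Decidable; Symmetric; Irreflexive)
open import Relation.Binary.Structures using (IsDecTotalOrder)
open import Relation.Binary.Construct.Closure.ReflexiveTransitive using (Star)
open import Relation.Binary.PropositionalEquality using (_≡_; _≢_)
open import Relation.Nullary.Decidable.Core using (yes; no)
open import Relation.Nullary.Negation.Core using (¬_)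

module Bounds {ℓ : Level} {A : Set ℓ} (_≤_ : Rel A ℓ) where

  UpperBound : (A → Set ℓ) → A → Set ℓ
  UpperBound P b = ∀ {y} → P y → y ≤ b

  LowerBound : (A → Set ℓ) → A → Set ℓ
  LowerBound P b = ∀ {y} → P y → b ≤ y

  IsSup : (A → Set ℓ) → A → Set ℓ
  IsSup P s = UpperBound P s × (∀ {b} → UpperBound P b → s ≤ b)

  IsInf : (A → Set ℓ) → A → Set ℓ
  IsInf P s = LowerBound P s × (∀ {b} → LowerBound P b → b ≤ s)

-- The standard library has no real numbers.  They are axiomatised, in the
-- classical way, as a Dedekind-complete ordered field; classically this
-- determines them up to unique isomorphism.

record RealField (ℓ : Level) : Set (lsuc ℓ) where
  infix  8 -_ _⁻¹
  infixl 7 _*_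
  infixl 6 _+_
  infix  4 _≈_ _≤_
  field
    Carrier           : Set ℓ
    _≈_               : Rel Carrier ℓ
    _≤_               : Rel Carrier ℓ
    _+_               : Carrier → Carrier → Carrier
    _*_               : Carrier → Carrier → Carrier
    -_                : Carrier → Carrier
    0#                : Carrier
    1#                : Carrier
    _⁻¹               : Carrier → Carrier
    isCommutativeRing : IsCommutativeRing _≈_ _+_ _*_ -_ 0# 1#
    0≉1               : ¬ (0# ≈ 1#)
    -- As usual for a total inverse, nothing is assumed about 0# ⁻¹.
    *-inverseʳ        : ∀ x → ¬ (x ≈ 0#) → x * x ⁻¹ ≈ 1#
    isDecTotalOrder   : IsDecTotalOrder _≈_ _≤_
    +-monoˡ-≤         : ∀ {x y} z → x ≤ y → x + z ≤ y + z
    *-nonNegative     : ∀ {x y} → 0# ≤ x → 0# ≤ y → 0# ≤ x * y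

  open Bounds _≤_ public

  field
    complete : (P : Carrier → Set ℓ) → ∃ P → ∃ (UpperBound P) → ∃ (IsSup P)

  commutativeRing : CommutativeRing ℓ ℓ
  commutativeRing = record { isCommutativeRing = isCommutativeRing }

  open CommutativeRing commutativeRing public using (semiring)
  open import Algebra.Properties.Semiring.Sum semiring public using (sum)
  open import Algebra.Properties.Semiring.Mult semiring public
    using () renaming (_×_ to _·_)

  IsSqrt : ℕ → Carrier → Set ℓ
  IsSqrt d r = 0# ≤ r × r * r ≈ d · 1#

record Graph (n : ℕ) : Set₁ where
  infix 4 _~_ _~?_
  field
    _~_    : Rel (Fin n) 0ℓ
    _~?_   : Decidable _~_
    sym    : Symmetric _~_
    irrefl : Irreflexive _≡_ _~_

module _ {n : ℕ} (G : Graph n) where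
  open Graph G

  -- Non-emptiness, part of connectedness, is implied by HasMaxDegree.
  Connected : Set
  Connected = ∀ u v → Star _~_ u v

  degree : Fin n → ℕ
  degree v = length (filter (v ~?_) (allFin n))

  HasMaxDegree : ℕ → Set
  HasMaxDegree d = (∀ v → degree v ℕ.≤ d) × (∃ λ v → degree v ≡ d)

  IsStar : ℕ → Fin n → Set
  IsStar d z = n ≡ suc d
             × (∀ v → v ≢ z → z ~ v)
             × (∀ u v → u ~ v → u ≡ z ⊎ v ≡ z)

  CanMove : Fin n → Fin n → Set
  CanMove u v = u ≡ v ⊎ u ~ v

  -- A history is the list of the killer's hops so far, most recent first;
  -- position h is where the cop stands after her turn that follows h, so
  -- position [] is where her first move takes her from the start vertex.
  record Strategy (start : Fin n) : Set where
    field
      position  : List (Fin n) → Fin n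
      firstMove : CanMove start (position [])
      nextMove  : ∀ k h → CanMove (position h) (position (k ∷ h))

  module Game {ℓ : Level} (ℝ : RealField ℓ) where
    open RealField ℝ

    record Distribution : Set ℓ where
      field
        prob        : Fin n → Carrier
        nonNegative : ∀ v → 0# ≤ prob v
        total       : sum prob ≈ 1#

    open Distribution public
    open Strategy public

    -- The probability that the cop wins within the next m hops, given the
    -- history h with the game undecided and the killer about to hop.  A hop
    -- onto the cop wins for the killer; otherwise the cop wins if her reply
    -- lands on the killer.
    winWithin : ∀ {c} → Strategy c → Distribution → ℕ → List (Fin n) → Carrier
    afterHop  : ∀ {c} → Strategy c → Distribution → ℕ → List (Fin n) → Fin n → Carrier

    winWithin σ p zero    h = 0#
    winWithin σ p (suc m) h = sum (λ k → prob p k * afterHop σ p m h k)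

    afterHop σ p m h k with k ≟ position σ h | position σ (k ∷ h) ≟ k
    ... | yes _ | _     = 0#
    ... | no _  | yes _ = 1#
    ... | no _  | no _  = winWithin σ p m (k ∷ h)

    -- The events "the cop wins within m hops" increase to "the cop wins".
    WinProbability : ∀ {c} → Strategy c → Distribution → Carrier → Set ℓ
    WinProbability σ p = IsSup (λ y → ∃ λ m → y ≈ winWithin σ p m [])

    -- The cop's optimal winning probability from the start vertex c when the
    -- killer uses p; her strategy may depend on p.
    CopValue : Fin n → Distribution → Carrier → Set ℓ
    CopValue c p = IsSup (λ y → Σ (Strategy c) λ σ → WinProbability σ p y)

    -- The killer chooses his distribution knowing c.
    StartValue : Fin n → Carrier → Set ℓ
    StartValue c = IsInf (λ y → ∃ λ p → CopValue c p y)

    GameValue : Carrier → Set ℓ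
    GameValue = IsSup (λ y → ∃ λ c → StartValue c y)

    -- Here r stands for √d.
    bound : Carrier → Carrier
    bound r = r * (1# + r) ⁻¹

    IsStarDistribution : Carrier → Fin n → Distribution → Set ℓ
    IsStarDistribution r z p = prob p z ≈ (1# + r) ⁻¹
                             × (∀ u v → u ≢ z → v ≢ z → prob p u ≈ prob p v)

{-# OPTIONS --safe #-}

-- Let a be the killer's probability of the cop's start z, a vertex of degree d.  If
-- a = 0 the cop walks through vertices of probability 0 until she stands next to the
-- support, and wins with probability 1.  Otherwise suppose that her value is at most
-- R/(1+R).  Standing still at z, or at a neighbour w of z, gives p(N(z)) ≤ R a and
-- a ≤ p(N(w)) ≤ R p(w); summing the latter over the neighbours gives d a ≤ R p(N(z)) ≤ R² a,
-- so R ≥ √d, and for R = √d every p(w) equals a/√d.  On a star this forces the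
-- stated distribution, against which no strategy does better.  If G is not a star,
-- some w adjacent to z has a further neighbour x, and comparing with the plan
-- "z, then w, then stay at x" excludes an R slightly larger than √d that depends on d
-- alone; hence the killer cannot even approach √d/(1+√d) in the infimum.

module Submission where

open import Defs
open import Algebra.Bundles using (CommutativeRing)
open import Data.Bool.Base using (if_then_else_; true; false)
open import Data.Empty using (⊥-elim)
open import Data.Fin.Base using (Fin; zero; suc)
open import Data.Fin.Properties as Fin using (any?)
open import Data.List.Base using (List; []; _∷_; length; filter; tabulate)
open import Data.List.Properties using (filter-accept; filter-reject; filter-all; length-tabulate)
import Data.List.Relation.Unary.All.Properties as All
open import Data.Nat.Base as ℕ using (ℕ; zero; suc)
import Data.Nat.Properties as ℕ
open import Data.Product.Base using (Σ; ∃; _×_; _,_; proj₁; proj₂)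
open import Data.Sum.Base using (_⊎_; inj₁; inj₂; [_,_]′)
open import Function.Base using (_∘_; id)
open import Function.Bundles using (_⇔_; mk⇔)
open import Level using (Level)
open import Relation.Binary.Bundles using (Poset)
open import Relation.Binary.Construct.Closure.ReflexiveTransitive using (Star; ε; _◅_)
open import Relation.Binary.PropositionalEquality as ≡ using (_≡_; _≢_)
open import Relation.Binary.Structures using (IsDecTotalOrder)
open import Relation.Nullary using (Dec; yes; no; does; ¬_; contradiction)
open import Relation.Nullary.Decidable using (¬?; _×-dec_; _⊎-dec_)

-- Ordered-field arithmetic, indicator sums and suprema of sequences.

module RealFieldProperties {ℓ : Level} (ℝ : RealField ℓ) where
  open RealField ℝ
  open CommutativeRing commutativeRing public
    using ( refl; sym; trans; reflexive; +-cong; +-congˡ; +-congʳ; +-comm; +-assoc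
          ; *-cong; *-congˡ; *-congʳ; *-comm; *-assoc; *-identityˡ; *-identityʳ
          ; +-identityˡ; +-identityʳ; zeroˡ; zeroʳ; -‿inverseˡ; -‿inverseʳ; distribˡ; distribʳ
          ; ring; commutativeSemiring)
  open IsDecTotalOrder isDecTotalOrder public
    using (_≤?_; antisym; ≤-respˡ-≈; ≤-respʳ-≈)
    renaming (refl to ≤-refl; total to ≤-total; trans to ≤-trans; reflexive to ≤-reflexive)
  open import Algebra.Properties.Ring ring using (-‿distribˡ-*; -‿involutive)
  open import Algebra.Properties.Semiring.Sum semiring public
    using (sum-cong-≋; ∑-distrib-+; *-distribˡ-sum; *-distribʳ-sum; sum-replicate-zero)
  open import Algebra.Solver.Ring.NaturalCoefficients.Default commutativeSemiring public
    using (solve; _:+_; _:*_; _:=_; con)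

  poset : Poset ℓ ℓ ℓ
  poset = record { isPartialOrder = IsDecTotalOrder.isPartialOrder isDecTotalOrder }

  module ≤-Reasoning where
    open import Relation.Binary.Reasoning.PartialOrder poset public
  open ≤-Reasoning

  +-monoʳ-≤ : ∀ {x y} z → x ≤ y → z + x ≤ z + y
  +-monoʳ-≤ {x} {y} z x≤y = begin
    z + x ≈⟨ +-comm z x ⟩
    x + z ≤⟨ +-monoˡ-≤ z x≤y ⟩
    y + z ≈⟨ +-comm y z ⟩
    z + y ∎

  +-mono-≤ : ∀ {x y u v} → x ≤ y → u ≤ v → x + u ≤ y + v
  +-mono-≤ {y = y} {u} x≤y u≤v = ≤-trans (+-monoˡ-≤ u x≤y) (+-monoʳ-≤ y u≤v)

  +-minus : ∀ x y → (x + y) + - y ≈ x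
  +-minus x y = trans (+-assoc x y (- y)) (trans (+-congˡ (-‿inverseʳ y)) (+-identityʳ x))

  minus-+ : ∀ x y → (x + - y) + y ≈ x
  minus-+ x y = trans (+-assoc x (- y) y) (trans (+-congˡ (-‿inverseˡ y)) (+-identityʳ x))

  +-cancelʳ-≤ : ∀ {x y} z → x + z ≤ y + z → x ≤ y
  +-cancelʳ-≤ {x} {y} z le = begin
    x             ≈⟨ +-minus x z ⟨
    x + z + - z   ≤⟨ +-monoˡ-≤ (- z) le ⟩
    y + z + - z   ≈⟨ +-minus y z ⟩
    y             ∎

  +-cancelʳ-≈ : ∀ {x y} z → x + z ≈ y + z → x ≈ y
  +-cancelʳ-≈ z eq = antisym (+-cancelʳ-≤ z (≤-reflexive eq)) (+-cancelʳ-≤ z (≤-reflexive (sym eq)))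

  0≤y-x : ∀ {x y} → x ≤ y → 0# ≤ y + - x
  0≤y-x {x} {y} x≤y = ≤-respˡ-≈ (-‿inverseʳ x) (+-monoˡ-≤ (- x) x≤y)

  *-monoˡ-≤ : ∀ {x y z} → 0# ≤ z → x ≤ y → z * x ≤ z * y
  *-monoˡ-≤ {x} {y} {z} 0≤z x≤y = begin
    z * x                       ≈⟨ +-identityˡ _ ⟨
    0# + z * x                  ≤⟨ +-monoˡ-≤ (z * x) (*-nonNegative 0≤z (0≤y-x x≤y)) ⟩
    z * (y + - x) + z * x       ≈⟨ distribˡ z _ x ⟨
    z * ((y + - x) + x)         ≈⟨ *-congˡ (minus-+ y x) ⟩
    z * y                       ∎

  *-monoʳ-≤ : ∀ {x y z} → 0# ≤ z → x ≤ y → x * z ≤ y * z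
  *-monoʳ-≤ {x} {y} {z} 0≤z x≤y = begin
    x * z ≈⟨ *-comm x z ⟩
    z * x ≤⟨ *-monoˡ-≤ 0≤z x≤y ⟩
    z * y ≈⟨ *-comm z y ⟩
    y * z ∎

  *-mono-≤ : ∀ {x y u v} → 0# ≤ y → 0# ≤ u → x ≤ y → u ≤ v → x * u ≤ y * v
  *-mono-≤ 0≤y 0≤u x≤y u≤v = ≤-trans (*-monoʳ-≤ 0≤u x≤y) (*-monoˡ-≤ 0≤y u≤v)

  +-nonNegative : ∀ {x y} → 0# ≤ x → 0# ≤ y → 0# ≤ x + y
  +-nonNegative 0≤x 0≤y = ≤-respˡ-≈ (+-identityˡ 0#) (+-mono-≤ 0≤x 0≤y)

  x≤x+y : ∀ {x y} → 0# ≤ y → x ≤ x + y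
  x≤x+y {x} 0≤y = ≤-respˡ-≈ (+-identityʳ x) (+-monoʳ-≤ x 0≤y)

  y≤x+y : ∀ {x y} → 0# ≤ x → y ≤ x + y
  y≤x+y {x} {y} 0≤x = ≤-respʳ-≈ (+-comm y x) (x≤x+y 0≤x)

  ≰⇒≥ : ∀ {x y} → ¬ (x ≤ y) → y ≤ x
  ≰⇒≥ {x} {y} x≰y = [ (λ x≤y → contradiction x≤y x≰y) , id ]′ (≤-total x y)

  0≤1 : 0# ≤ 1#
  0≤1 with ≤-total 0# 1#
  ... | inj₁ le = le
  ... | inj₂ 1≤0 = begin
    0#              ≤⟨ *-nonNegative 0≤-1 0≤-1 ⟩
    - 1# * - 1#     ≈⟨ -‿distribˡ-* 1# (- 1#) ⟨
    - (1# * - 1#)   ≈⟨ -‿cong (*-identityˡ (- 1#)) ⟩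
    - (- 1#)        ≈⟨ -‿involutive 1# ⟩
    1#              ∎
    where
    open CommutativeRing commutativeRing using (-‿cong)
    0≤-1 : 0# ≤ - 1#
    0≤-1 = ≤-respʳ-≈ (+-identityˡ (- 1#)) (0≤y-x 1≤0)

  1≰0 : ¬ (1# ≤ 0#)
  1≰0 1≤0 = 0≉1 (antisym 0≤1 1≤0)

  x+1≰x : ∀ {x} → ¬ (x + 1# ≤ x)
  x+1≰x {x} le = 1≰0 (+-cancelʳ-≤ x (begin
    1# + x ≈⟨ +-comm 1# x ⟩
    x + 1# ≤⟨ le ⟩
    x      ≈⟨ +-identityˡ x ⟨
    0# + x ∎))

  -- Strict positivity is expressed throughout as `¬ (x ≤ 0#)`, which a case split on `_≤?_`
  -- supplies directly; here it becomes the hypothesis of `*-inverseʳ`.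
  ≰0⇒≉0 : ∀ {x} → ¬ (x ≤ 0#) → ¬ (x ≈ 0#)
  ≰0⇒≉0 x≰0 x≈0 = x≰0 (≤-reflexive x≈0)

  1+-positive : ∀ {x} → 0# ≤ x → ¬ (1# + x ≤ 0#)
  1+-positive 0≤x le = 1≰0 (≤-trans (x≤x+y 0≤x) le)

  *-inverseˡ : ∀ x → ¬ (x ≈ 0#) → x ⁻¹ * x ≈ 1#
  *-inverseˡ x x≉0 = trans (*-comm _ x) (*-inverseʳ x x≉0)

  ⁻¹-nonNegative : ∀ {x} → ¬ (x ≤ 0#) → 0# ≤ x ⁻¹
  ⁻¹-nonNegative {x} x≰0 with ≤-total 0# (x ⁻¹)
  ... | inj₁ le = le
  ... | inj₂ x⁻¹≤0 = ⊥-elim (1≰0 (begin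
    1#       ≈⟨ *-inverseʳ x (≰0⇒≉0 x≰0) ⟨
    x * x ⁻¹ ≤⟨ *-monoˡ-≤ (≰⇒≥ x≰0) x⁻¹≤0 ⟩
    x * 0#   ≈⟨ zeroʳ x ⟩
    0#       ∎))

  ⁻¹-*-cancel : ∀ {x} y → ¬ (x ≈ 0#) → x ⁻¹ * (x * y) ≈ y
  ⁻¹-*-cancel {x} y x≉0 = trans (sym (*-assoc _ x y)) (trans (*-congʳ (*-inverseˡ x x≉0)) (*-identityˡ y))

  *-cancelˡ-≤ : ∀ {x y z} → ¬ (z ≤ 0#) → z * x ≤ z * y → x ≤ y
  *-cancelˡ-≤ {x} {y} {z} z≰0 le = begin
    x               ≈⟨ ⁻¹-*-cancel x (≰0⇒≉0 z≰0) ⟨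
    z ⁻¹ * (z * x)  ≤⟨ *-monoˡ-≤ (⁻¹-nonNegative z≰0) le ⟩
    z ⁻¹ * (z * y)  ≈⟨ ⁻¹-*-cancel y (≰0⇒≉0 z≰0) ⟩
    y               ∎

  *-cancelˡ-≈ : ∀ {x y z} → ¬ (z ≈ 0#) → z * x ≈ z * y → x ≈ y
  *-cancelˡ-≈ {x} {y} z≉0 eq =
    trans (sym (⁻¹-*-cancel x z≉0)) (trans (*-congˡ eq) (⁻¹-*-cancel y z≉0))

  ·-mono-≤ : ∀ {m n} → m ℕ.≤ n → m · 1# ≤ n · 1#
  ·-mono-≤ {n = zero}  ℕ.z≤n     = ≤-refl
  ·-mono-≤ {n = suc n} ℕ.z≤n     = +-nonNegative 0≤1 (·-mono-≤ {0} {n} ℕ.z≤n)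
  ·-mono-≤             (ℕ.s≤s le) = +-monoʳ-≤ 1# (·-mono-≤ le)

  sum-mono-≤ : ∀ {n} {f g : Fin n → Carrier} → (∀ k → f k ≤ g k) → sum f ≤ sum g
  sum-mono-≤ {zero}  f≤g = ≤-refl
  sum-mono-≤ {suc n} f≤g = +-mono-≤ (f≤g zero) (sum-mono-≤ (f≤g ∘ suc))

  sum-nonNegative : ∀ {n} {f : Fin n → Carrier} → (∀ k → 0# ≤ f k) → 0# ≤ sum f
  sum-nonNegative {n} 0≤f = ≤-respˡ-≈ (sum-replicate-zero n) (sum-mono-≤ 0≤f)

  𝟙 : {A : Set} → Dec A → Carrier
  𝟙 a? = if does a? then 1# else 0#

  𝟙-nonNegative : {A : Set} (a? : Dec A) → 0# ≤ 𝟙 a?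
  𝟙-nonNegative (yes _) = 0≤1
  𝟙-nonNegative (no _)  = ≤-refl

  𝟙-yes : {A : Set} (a? : Dec A) → A → 𝟙 a? ≈ 1#
  𝟙-yes (yes _) _ = refl
  𝟙-yes (no ¬a) a = contradiction a ¬a

  𝟙-no : {A : Set} (a? : Dec A) → ¬ A → 𝟙 a? ≈ 0#
  𝟙-no (yes a) ¬a = contradiction a ¬a
  𝟙-no (no _)  _  = refl

  sum-𝟙-≟ : ∀ {n} (f : Fin n → Carrier) i → sum (λ k → 𝟙 (k Fin.≟ i) * f k) ≈ f i
  sum-𝟙-≟ {suc n} f zero = begin-equality
    1# * f zero + sum (λ k → 0# * f (suc k))
      ≈⟨ +-cong (*-identityˡ _) (trans (sum-cong-≋ (λ k → zeroˡ (f (suc k)))) (sum-replicate-zero n)) ⟩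
    f zero + 0#    ≈⟨ +-identityʳ _ ⟩
    f zero         ∎
  -- `does (suc k ≟ suc i)` reduces to `does (k ≟ i)`, so the recursive call matches the remaining
  -- sum definitionally.
  sum-𝟙-≟ {suc n} f (suc i) =
    trans (+-cong (zeroˡ _) (sum-𝟙-≟ (f ∘ suc) i)) (+-identityˡ _)

  sum-𝟙-filter : ∀ {m} {A : Set} {P : A → Set} (P? : ∀ a → Dec (P a)) (f : Fin m → A) →
                 sum (λ i → 𝟙 (P? (f i))) ≈ length (filter P? (tabulate f)) · 1#
  sum-𝟙-filter {zero}  P? f = refl
  sum-𝟙-filter {suc m} P? f with does (P? (f zero))
  ... | true  = +-congˡ (sum-𝟙-filter P? (f ∘ suc))
  ... | false = trans (+-identityˡ _) (sum-𝟙-filter P? (f ∘ suc))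

  -- Unfolds to the set whose supremum defines `WinProbability`, so the two lemmas below apply there
  -- without conversion.
  Range : (ℕ → Carrier) → Carrier → Set ℓ
  Range f y = ∃ λ m → y ≈ f m

  ≤sup : ∀ {f s} → IsSup (Range f) s → ∀ m → f m ≤ s
  ≤sup sup m = proj₁ sup (m , refl)

  sup≤ : ∀ {f s b} → IsSup (Range f) s → (∀ m → f m ≤ b) → s ≤ b
  sup≤ sup f≤b = proj₂ sup (λ { (m , y≈fm) → ≤-respˡ-≈ (sym y≈fm) (f≤b m) })

  -- Carries a one-step recursion for winning probabilities to the limit. If `b` vanishes, the
  -- hypothesis at index 0 suffices; otherwise `b ⁻¹ * (v + - a)` bounds every `f m`, hence also
  -- `s`.
  sup-affine-≤ : ∀ {f s a b v} → 0# ≤ b → IsSup (Range f) s →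
                 (∀ m → a + b * f m ≤ v) → a + b * s ≤ v
  sup-affine-≤ {f} {s} {a} {b} {v} 0≤b sup le with b ≤? 0#
  ... | yes b≤0 = begin
    a + b * s    ≈⟨ +-congˡ (bx≈0 s) ⟩
    a + 0#       ≈⟨ +-congˡ (bx≈0 (f 0)) ⟨
    a + b * f 0  ≤⟨ le 0 ⟩
    v            ∎
    where
    bx≈0 : ∀ x → b * x ≈ 0#
    bx≈0 x = trans (*-congʳ (antisym b≤0 0≤b)) (zeroˡ x)
  ... | no b≰0 = begin
    a + b * s                     ≤⟨ +-monoʳ-≤ a (*-monoˡ-≤ 0≤b (sup≤ sup fm≤)) ⟩
    a + b * (b ⁻¹ * (v + - a))    ≈⟨ +-congˡ (trans (sym (*-assoc b _ _)) (trans (*-congʳ (*-inverseʳ b (≰0⇒≉0 b≰0))) (*-identityˡ _))) ⟩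
    a + (v + - a)                 ≈⟨ +-comm a _ ⟩
    (v + - a) + a                 ≈⟨ minus-+ v a ⟩
    v                             ∎
    where
    fm≤ : ∀ m → f m ≤ b ⁻¹ * (v + - a)
    fm≤ m = begin
      f m                                 ≈⟨ ⁻¹-*-cancel (f m) (≰0⇒≉0 b≰0) ⟨
      b ⁻¹ * (b * f m)                    ≤⟨ *-monoˡ-≤ (⁻¹-nonNegative b≰0) (+-cancelʳ-≤ a (begin
        b * f m + a       ≈⟨ +-comm _ a ⟩
        a + b * f m       ≤⟨ le m ⟩
        v                 ≈⟨ minus-+ v a ⟨
        (v + - a) + a     ∎)) ⟩
      b ⁻¹ * (v + - a)                    ∎

-- Sums over neighbourhoods.

module GameProperties {ℓ : Level} (ℝ : RealField ℓ) {n : ℕ} (G : Graph n) where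
  open RealField ℝ
  open RealFieldProperties ℝ
  open ≤-Reasoning
  open Graph G using (_~_; _~?_; irrefl) renaming (sym to ~-sym)
  open Game G ℝ

  -- At `prob p` this is the probability that a hop lands next to `u`; at the constant `1#` it is
  -- the degree as a field element. Degree counts and probability estimates thus share the same
  -- lemmas.
  neighbourSum : Fin n → (Fin n → Carrier) → Carrier
  neighbourSum u f = sum (λ k → 𝟙 (u ~? k) * f k)

  neighbourSum-1 : ∀ u → neighbourSum u (λ _ → 1#) ≈ degree G u · 1#
  neighbourSum-1 u =
    trans (sum-cong-≋ (λ k → *-identityʳ (𝟙 (u ~? k)))) (sum-𝟙-filter (u ~?_) id)

  neighbourSum-const : ∀ u {f x} → (∀ k → u ~ k → f k ≈ x) →
                       neighbourSum u f ≈ neighbourSum u (λ _ → 1#) * x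
  neighbourSum-const u {f} {x} f≈x = begin-equality
    neighbourSum u f                           ≈⟨ sum-cong-≋ pointwise ⟩
    sum (λ k → 𝟙 (u ~? k) * 1# * x)            ≈⟨ *-distribʳ-sum x (λ k → 𝟙 (u ~? k) * 1#) ⟨
    neighbourSum u (λ _ → 1#) * x              ∎
    where
    pointwise : ∀ k → 𝟙 (u ~? k) * f k ≈ 𝟙 (u ~? k) * 1# * x
    pointwise k with u ~? k
    ... | yes u~k = trans (*-congˡ (f≈x k u~k)) (*-congʳ (sym (*-identityʳ 1#)))
    ... | no _    = trans (zeroˡ _) (sym (trans (*-congʳ (zeroˡ 1#)) (zeroˡ x)))

  neighbourSum-nonNegative : ∀ u {f} → (∀ k → 0# ≤ f k) → 0# ≤ neighbourSum u f
  neighbourSum-nonNegative u 0≤f =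
    sum-nonNegative (λ k → *-nonNegative (𝟙-nonNegative (u ~? k)) (0≤f k))

  pair≤neighbourSum : ∀ {u v w f} → (∀ k → 0# ≤ f k) → u ~ v → u ~ w → v ≢ w →
                      f v + f w ≤ neighbourSum u f
  pair≤neighbourSum {u} {v} {w} {f} 0≤f u~v u~w v≢w = begin
    f v + f w    ≈⟨ +-cong (sum-𝟙-≟ f v) (sum-𝟙-≟ f w) ⟨
    _            ≈⟨ ∑-distrib-+ (λ k → 𝟙 (k Fin.≟ v) * f k) (λ k → 𝟙 (k Fin.≟ w) * f k) ⟨
    sum (λ k → 𝟙 (k Fin.≟ v) * f k + 𝟙 (k Fin.≟ w) * f k)  ≤⟨ sum-mono-≤ pointwise ⟩
    neighbourSum u f ∎
    where
    pointwise : ∀ k → 𝟙 (k Fin.≟ v) * f k + 𝟙 (k Fin.≟ w) * f k ≤ 𝟙 (u ~? k) * f k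
    pointwise k with k Fin.≟ v | k Fin.≟ w
    ... | yes ≡.refl | yes ≡.refl = contradiction ≡.refl v≢w
    ... | yes ≡.refl | no _ = ≤-reflexive
      (trans (+-congˡ (zeroˡ _)) (trans (+-identityʳ _) (*-congʳ (sym (𝟙-yes (u ~? v) u~v)))))
    ... | no _ | yes ≡.refl = ≤-reflexive
      (trans (+-congʳ (zeroˡ _)) (trans (+-identityˡ _) (*-congʳ (sym (𝟙-yes (u ~? w) u~w)))))
    ... | no _ | no _ = ≤-respˡ-≈
      (sym (trans (+-cong (zeroˡ _) (zeroˡ _)) (+-identityʳ 0#)))
      (*-nonNegative (𝟙-nonNegative (u ~? k)) (0≤f k))

  single≤neighbourSum : ∀ {u v f} → (∀ k → 0# ≤ f k) → u ~ v → f v ≤ neighbourSum u f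
  single≤neighbourSum {u} {v} {f} 0≤f u~v = begin
    f v                               ≈⟨ sum-𝟙-≟ f v ⟨
    sum (λ k → 𝟙 (k Fin.≟ v) * f k)   ≤⟨ sum-mono-≤ pointwise ⟩
    neighbourSum u f ∎
    where
    pointwise : ∀ k → 𝟙 (k Fin.≟ v) * f k ≤ 𝟙 (u ~? k) * f k
    pointwise k with k Fin.≟ v
    ... | yes ≡.refl = ≤-reflexive (*-congʳ (sym (𝟙-yes (u ~? v) u~v)))
    ... | no _ = ≤-respˡ-≈ (sym (zeroˡ _)) (*-nonNegative (𝟙-nonNegative (u ~? k)) (0≤f k))

  -- If f ≥ x on all neighbours of u, then the neighbours other than v contribute at
  -- least (deg u − 1) x, written without subtraction.
  neighbourSum-replace : ∀ {u v f x} → u ~ v → (∀ k → u ~ k → x ≤ f k) →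
                         neighbourSum u (λ _ → 1#) * x + f v ≤ neighbourSum u f + x
  neighbourSum-replace {u} {v} {f} {x} u~v x≤f = begin
    neighbourSum u (λ _ → 1#) * x + f v
      ≈⟨ +-cong (*-distribʳ-sum x (λ k → 𝟙 (u ~? k) * 1#)) (sym (sum-𝟙-≟ f v)) ⟩
    _ ≈⟨ ∑-distrib-+ (λ k → 𝟙 (u ~? k) * 1# * x) (λ k → 𝟙 (k Fin.≟ v) * f k) ⟨
    sum (λ k → 𝟙 (u ~? k) * 1# * x + 𝟙 (k Fin.≟ v) * f k)
      ≤⟨ sum-mono-≤ pointwise ⟩
    sum (λ k → 𝟙 (u ~? k) * f k + 𝟙 (k Fin.≟ v) * x)
      ≈⟨ ∑-distrib-+ (λ k → 𝟙 (u ~? k) * f k) (λ k → 𝟙 (k Fin.≟ v) * x) ⟩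
    _ ≈⟨ +-congˡ (sum-𝟙-≟ (λ _ → x) v) ⟩
    neighbourSum u f + x ∎
    where
    pointwise : ∀ k → 𝟙 (u ~? k) * 1# * x + 𝟙 (k Fin.≟ v) * f k ≤ 𝟙 (u ~? k) * f k + 𝟙 (k Fin.≟ v) * x
    pointwise k with k Fin.≟ v
    ... | yes ≡.refl = ≤-reflexive (begin-equality
      𝟙 (u ~? v) * 1# * x + 1# * f v
        ≈⟨ +-congʳ (*-congʳ (*-congʳ (𝟙-yes (u ~? v) u~v))) ⟩
      1# * 1# * x + 1# * f v
        ≈⟨ solve 2 (λ x y → con 1 :* con 1 :* x :+ con 1 :* y := con 1 :* y :+ con 1 :* x) refl x (f v) ⟩
      1# * f v + 1# * x
        ≈⟨ +-congʳ (*-congʳ (𝟙-yes (u ~? v) u~v)) ⟨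
      𝟙 (u ~? v) * f v + 1# * x ∎)
    ... | no _ with u ~? k
    ...   | yes u~k = +-mono-≤ (≤-respˡ-≈ (*-congʳ (sym (*-identityʳ 1#))) (*-monoˡ-≤ 0≤1 (x≤f k u~k)))
                               (≤-reflexive (trans (zeroˡ _) (sym (zeroˡ _))))
    ...   | no _ = ≤-reflexive (solve 2 (λ x y → con 0 :* con 1 :* x :+ con 0 :* y := con 0 :* y :+ con 0 :* x) refl x (f k))

  degree≈ : ∀ {u d} → degree G u ≡ d → neighbourSum u (λ _ → 1#) ≈ d · 1#
  degree≈ {u} deg≡d = trans (neighbourSum-1 u) (reflexive (≡.cong (_· 1#) deg≡d))

  -- The pair estimate for the constant function `1#`. In the non-star case this `2 ≤ d` is the
  -- surplus that yields the contradiction.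
  two-neighbours : ∀ {u v w d} → HasMaxDegree G d → u ~ v → u ~ w → v ≢ w → 1# + 1# ≤ d · 1#
  two-neighbours {u} {d = d} (deg≤d , _) u~v u~w v≢w = begin
    1# + 1#                     ≤⟨ pair≤neighbourSum (λ _ → 0≤1) u~v u~w v≢w ⟩
    neighbourSum u (λ _ → 1#)   ≈⟨ neighbourSum-1 u ⟩
    degree G u · 1#             ≤⟨ ·-mono-≤ (deg≤d u) ⟩
    d · 1#                      ∎

  outside : ∀ u k → Dec (¬ (k ≡ u ⊎ u ~ k))
  outside u k = ¬? ((k Fin.≟ u) ⊎-dec (u ~? k))

  -- Winning probabilities and existence of the game values.

  module _ {c : Fin n} (σ : Strategy G c) (p : Distribution) where

    -- `afterHop` is stuck until both of its decisions are abstracted together. This lemma and the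
    -- next three do so, leaving later proofs only the conditions for each outcome.
    afterHop-≤ : ∀ m h k {y} → 0# ≤ y →
                 (k ≢ position σ h → position σ (k ∷ h) ≡ k → 1# ≤ y) →
                 (k ≢ position σ h → winWithin σ p m (k ∷ h) ≤ y) →
                 afterHop σ p m h k ≤ y
    afterHop-≤ m h k 0≤y win play with k Fin.≟ position σ h | position σ (k ∷ h) Fin.≟ k
    ... | yes _    | _        = 0≤y
    ... | no k≢pos | yes pos≡k = win k≢pos pos≡k
    ... | no k≢pos | no _     = play k≢pos

    afterHop-lost : ∀ m h k → k ≡ position σ h → afterHop σ p m h k ≈ 0#
    afterHop-lost m h k k≡pos with k Fin.≟ position σ h | position σ (k ∷ h) Fin.≟ k
    ... | yes _    | _ = refl
    ... | no k≢pos | _ = contradiction k≡pos k≢pos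

    afterHop-won : ∀ m h k → k ≢ position σ h → position σ (k ∷ h) ≡ k → afterHop σ p m h k ≈ 1#
    afterHop-won m h k k≢pos pos≡k with k Fin.≟ position σ h | position σ (k ∷ h) Fin.≟ k
    ... | yes k≡pos | _        = contradiction k≡pos k≢pos
    ... | no _      | yes _    = refl
    ... | no _      | no pos≢k = contradiction pos≡k pos≢k

    ≤-afterHop : ∀ m h k {y} → k ≢ position σ h → y ≤ 1# → y ≤ winWithin σ p m (k ∷ h) →
                 y ≤ afterHop σ p m h k
    ≤-afterHop m h k k≢pos y≤1 y≤win with k Fin.≟ position σ h | position σ (k ∷ h) Fin.≟ k
    ... | yes k≡pos | _     = contradiction k≡pos k≢pos
    ... | no _      | yes _ = y≤1
    ... | no _      | no _  = y≤win

    winWithin-nonNegative : ∀ m h → 0# ≤ winWithin σ p m h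
    afterHop-nonNegative : ∀ m h k → 0# ≤ afterHop σ p m h k

    winWithin-nonNegative zero    h = ≤-refl
    winWithin-nonNegative (suc m) h =
      sum-nonNegative (λ k → *-nonNegative (nonNegative p k) (afterHop-nonNegative m h k))

    afterHop-nonNegative m h k with k Fin.≟ position σ h | position σ (k ∷ h) Fin.≟ k
    ... | yes _ | _     = ≤-refl
    ... | no _  | yes _ = 0≤1
    ... | no _  | no _  = winWithin-nonNegative m (k ∷ h)

    winWithin≤1 : ∀ m h → winWithin σ p m h ≤ 1#
    afterHop≤1 : ∀ m h k → afterHop σ p m h k ≤ 1#

    winWithin≤1 zero    h = 0≤1
    winWithin≤1 (suc m) h = begin
      sum (λ k → prob p k * afterHop σ p m h k)
        ≤⟨ sum-mono-≤ (λ k → *-monoˡ-≤ (nonNegative p k) (afterHop≤1 m h k)) ⟩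
      sum (λ k → prob p k * 1#)   ≈⟨ sum-cong-≋ (λ k → *-identityʳ (prob p k)) ⟩
      sum (prob p)                ≈⟨ total p ⟩
      1#                          ∎

    afterHop≤1 m h k = afterHop-≤ m h k 0≤1 (λ _ _ → ≤-refl) (λ _ → winWithin≤1 m (k ∷ h))

    winProbability-exists : ∃ (WinProbability σ p)
    winProbability-exists = complete _ (0# , 0 , refl)
      (1# , λ { (m , y≈) → ≤-respˡ-≈ (sym y≈) (winWithin≤1 m []) })

    winProbability≤ : ∀ {y b} → (∀ m → winWithin σ p m [] ≤ b) → WinProbability σ p y → y ≤ b
    winProbability≤ win≤b sup = sup≤ sup win≤b

  -- The upper-bound half of `CopValue c p Y`. Estimates of the cop's value from below use this half
  -- alone, so they also apply to the arbitrary upper bound in the leastness half of a supremum.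
  Guaranteed : Fin n → Distribution → Carrier → Set ℓ
  Guaranteed c p = UpperBound (λ y → Σ (Strategy G c) λ σ → WinProbability σ p y)

  winWithin≤value : ∀ {c p Y} (σ : Strategy G c) m → Guaranteed c p Y → winWithin σ p m [] ≤ Y
  winWithin≤value {p = p} σ m Y-ub = let y , sup = winProbability-exists σ p in
    ≤-trans (≤sup sup m) (Y-ub (σ , sup))

  copValue-exists : ∀ c p → ∃ (CopValue c p)
  copValue-exists c p = complete _ (_ , stationary , proj₂ (winProbability-exists stationary p))
    (1# , λ { (σ , sup) → winProbability≤ σ p (λ m → winWithin≤1 σ p m []) sup })
    where
    stationary : Strategy G c
    stationary = record { position = λ _ → c ; firstMove = inj₁ ≡.refl ; nextMove = λ _ _ → inj₁ ≡.refl }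

  pointMass : Fin n → Distribution
  pointMass v = record
    { prob        = λ k → 𝟙 (k Fin.≟ v) * 1#
    ; nonNegative = λ k → *-nonNegative (𝟙-nonNegative (k Fin.≟ v)) 0≤1
    ; total       = sum-𝟙-≟ (λ _ → 1#) v
    }

  -- Completeness is given for suprema, so the infimum is built as the supremum of the lower bounds.
  -- That set contains `b` and is bounded above by the cop's value against a point mass.
  startValue-exists : ∀ {c b} → LowerBound (λ y → ∃ λ p → CopValue c p y) b → ∃ (StartValue c)
  startValue-exists {c} {b} lb =
    let Y , value = copValue-exists c (pointMass c)
        s , ub , least = complete (LowerBound P) (b , lb) (Y , λ lb′ → lb′ (pointMass c , value))
    in s , (λ y∈ → least (λ lb′ → lb′ y∈)) , ub
    where
    P : Carrier → Set ℓ
    P y = ∃ λ p → CopValue c p y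

  -- Plans: follow a walk, then stand still, and seize any killer who lands next to the cop.

  Plan : Set
  Plan = ∃ λ u → ∃ (Star _~_ u)

  stay : Fin n → Plan
  stay u = u , u , ε

  tail : Plan → Plan
  tail (u , _ , ε)     = stay u
  tail (_ , _ , _ ◅ π) = _ , _ , π

  tail-move : ∀ s → CanMove G (proj₁ s) (proj₁ (tail s))
  tail-move (_ , _ , ε)       = inj₁ ≡.refl
  tail-move (_ , _ , u~v ◅ _) = inj₂ u~v

  -- The cop leaves her walk only to step onto a killer who has just landed next to her. The game is
  -- then decided, so `stay k` is an arbitrary continuation.
  advance : Plan → Fin n → Plan
  advance s k = if does (proj₁ s ~? k) then stay k else tail s

  advance-move : ∀ s k → CanMove G (proj₁ s) (proj₁ (advance s k))
  advance-move s k with proj₁ s ~? k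
  ... | yes u~k = inj₂ u~k
  ... | no _    = tail-move s

  advance-adjacent : ∀ s k → proj₁ s ~ k → advance s k ≡ stay k
  advance-adjacent s k u~k with proj₁ s ~? k
  ... | yes _   = ≡.refl
  ... | no ¬u~k = contradiction u~k ¬u~k

  advance-nonadjacent : ∀ s k → ¬ (proj₁ s ~ k) → advance s k ≡ tail s
  advance-nonadjacent s k ¬u~k with proj₁ s ~? k
  ... | yes u~k = contradiction u~k ¬u~k
  ... | no _    = ≡.refl

  planAfter : Plan → List (Fin n) → Plan
  planAfter s []      = s
  planAfter s (k ∷ h) = advance (planAfter s h) k

  follow : ∀ {c} s → CanMove G c (proj₁ s) → Strategy G c
  follow s move = record
    { position  = λ h → proj₁ (planAfter s h)
    ; firstMove = move
    ; nextMove  = λ k h → advance-move (planAfter s h) k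
    }

  -- Winning probability of a plan against a fixed distribution.

  module PlanValue (p : Distribution) where

    hit miss : Fin n → Carrier
    hit u  = neighbourSum u (prob p)
    miss u = sum (λ k → 𝟙 (outside u k) * prob p k)

    hit-nonNegative : ∀ u → 0# ≤ hit u
    hit-nonNegative u = neighbourSum-nonNegative u (nonNegative p)

    miss-nonNegative : ∀ u → 0# ≤ miss u
    miss-nonNegative u =
      sum-nonNegative (λ k → *-nonNegative (𝟙-nonNegative (outside u k)) (nonNegative p k))

    total-split : ∀ u → prob p u + hit u + miss u ≈ 1#
    total-split u = begin-equality
      prob p u + hit u + miss u
        ≈⟨ +-congʳ (+-congʳ (sym (sum-𝟙-≟ (prob p) u))) ⟩
      _ ≈⟨ +-congʳ (sym (∑-distrib-+ (λ k → 𝟙 (k Fin.≟ u) * prob p k) (λ k → 𝟙 (u ~? k) * prob p k))) ⟩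
      _ ≈⟨ ∑-distrib-+ (λ k → 𝟙 (k Fin.≟ u) * prob p k + 𝟙 (u ~? k) * prob p k) (λ k → 𝟙 (outside u k) * prob p k) ⟨
      _ ≈⟨ sum-cong-≋ pointwise ⟩
      sum (prob p) ≈⟨ total p ⟩
      1# ∎
      where
      pointwise : ∀ k → 𝟙 (k Fin.≟ u) * prob p k + 𝟙 (u ~? k) * prob p k + 𝟙 (outside u k) * prob p k ≈ prob p k
      pointwise k with k Fin.≟ u | u ~? k
      ... | yes ≡.refl | yes u~u = contradiction u~u (irrefl ≡.refl)
      ... | yes _      | no _ = solve 1 (λ x → con 1 :* x :+ con 0 :* x :+ con 0 :* x := x) refl (prob p k)
      ... | no _       | yes _ = solve 1 (λ x → con 0 :* x :+ con 1 :* x :+ con 0 :* x := x) refl (prob p k)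
      ... | no _       | no _ = solve 1 (λ x → con 0 :* x :+ con 0 :* x :+ con 1 :* x := x) refl (prob p k)

    hit+miss≤1 : ∀ u → hit u + miss u ≤ 1#
    hit+miss≤1 u = begin
      hit u + miss u              ≤⟨ y≤x+y (nonNegative p u) ⟩
      prob p u + (hit u + miss u) ≈⟨ +-assoc _ _ _ ⟨
      prob p u + hit u + miss u   ≈⟨ total-split u ⟩
      1#                          ∎

    prob+hit≤1 : ∀ u → prob p u + hit u ≤ 1#
    prob+hit≤1 u = ≤-trans (x≤x+y (miss-nonNegative u)) (≤-reflexive (total-split u))

    -- Needs no histories: while the killer keeps missing, the state of a plan depends only on the
    -- number of turns played.
    planWin : ℕ → Plan → Carrier
    planWin zero    s = 0#
    planWin (suc m) s = hit (proj₁ s) + miss (proj₁ s) * planWin m (tail s)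

    planWin≤1 : ∀ m s → planWin m s ≤ 1#
    planWin≤1 zero    s = 0≤1
    planWin≤1 (suc m) s = begin
      hit u + miss u * planWin m (tail s)
        ≤⟨ +-monoʳ-≤ (hit u) (*-monoˡ-≤ (miss-nonNegative u) (planWin≤1 m (tail s))) ⟩
      hit u + miss u * 1#   ≈⟨ +-congˡ (*-identityʳ (miss u)) ⟩
      hit u + miss u        ≤⟨ hit+miss≤1 u ⟩
      1#                    ∎
      where u = proj₁ s

    -- Compared hop by hop: a hop onto the cop contributes zero on the left, a hop onto a neighbour
    -- is answered by capture, and any other hop leaves the plan at its `tail`, where induction
    -- applies.
    planWin≤winWithin : ∀ {c} s (move : CanMove G c (proj₁ s)) m h →
                        planWin m (planAfter s h) ≤ winWithin (follow s move) p m h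
    planWin≤winWithin s move zero    h = ≤-refl
    planWin≤winWithin s move (suc m) h = begin
      hit u + miss u * W
        ≈⟨ +-congˡ (*-distribʳ-sum W (λ k → 𝟙 (outside u k) * prob p k)) ⟩
      _ ≈⟨ ∑-distrib-+ (λ k → 𝟙 (u ~? k) * prob p k) (λ k → 𝟙 (outside u k) * prob p k * W) ⟨
      sum (λ k → 𝟙 (u ~? k) * prob p k + 𝟙 (outside u k) * prob p k * W)
        ≤⟨ sum-mono-≤ pointwise ⟩
      sum (λ k → prob p k * afterHop σ p m h k) ∎
      where
      σ = follow s move
      u = proj₁ (planAfter s h)
      W = planWin m (tail (planAfter s h))
      pointwise : ∀ k → 𝟙 (u ~? k) * prob p k + 𝟙 (outside u k) * prob p k * W ≤ prob p k * afterHop σ p m h k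
      pointwise k = by-cases (k Fin.≟ u) (u ~? k)
        where
        x = prob p k
        A = afterHop σ p m h k
        by-cases : (k≟u : Dec (k ≡ u)) (u~?k : Dec (u ~ k)) →
                   𝟙 u~?k * x + 𝟙 (¬? (k≟u ⊎-dec u~?k)) * x * W ≤ x * A
        by-cases (yes ≡.refl) (yes u~u) = contradiction u~u (irrefl ≡.refl)
        by-cases (yes _) (no _) = ≤-respˡ-≈
          (solve 2 (λ x W → con 0 := con 0 :* x :+ con 0 :* x :* W) refl x W)
          (*-nonNegative (nonNegative p k) (afterHop-nonNegative σ p m h k))
        by-cases (no k≢u) (yes u~k) = ≤-reflexive (begin-equality
          1# * x + 0# * x * W
            ≈⟨ solve 2 (λ x W → con 1 :* x :+ con 0 :* x :* W := x :* con 1) refl x W ⟩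
          x * 1#   ≈⟨ *-congˡ (afterHop-won σ p m h k k≢u
                       (≡.cong proj₁ (advance-adjacent (planAfter s h) k u~k))) ⟨
          x * A    ∎)
        by-cases (no k≢u) (no ¬u~k) = begin
          0# * x + 1# * x * W
            ≈⟨ solve 2 (λ x W → con 0 :* x :+ con 1 :* x :* W := x :* W) refl x W ⟩
          x * W    ≤⟨ *-monoˡ-≤ (nonNegative p k) (≤-afterHop σ p m h k k≢u (planWin≤1 m _) W≤) ⟩
          x * A    ∎
          where
          W≤ : W ≤ winWithin σ p m (k ∷ h)
          W≤ = ≡.subst (λ t → planWin m t ≤ winWithin σ p m (k ∷ h))
                 (advance-nonadjacent (planAfter s h) k ¬u~k) (planWin≤winWithin s move m (k ∷ h))

    private
      planValue-exists : ∀ s → ∃ (IsSup (Range (λ m → planWin m s)))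
      planValue-exists s = complete _ (0# , 0 , refl)
        (1# , λ { (m , y≈) → ≤-respˡ-≈ (sym y≈) (planWin≤1 m s) })

    planValue : Plan → Carrier
    planValue s = proj₁ (planValue-exists s)

    planValue-isSup : ∀ s → IsSup (Range (λ m → planWin m s)) (planValue s)
    planValue-isSup s = proj₂ (planValue-exists s)

    planValue-nonNegative : ∀ s → 0# ≤ planValue s
    planValue-nonNegative s = ≤sup (planValue-isSup s) 0

    planValue≤1 : ∀ s → planValue s ≤ 1#
    planValue≤1 s = sup≤ (planValue-isSup s) (λ m → planWin≤1 m s)

    planValue-step : ∀ s → hit (proj₁ s) + miss (proj₁ s) * planValue (tail s) ≤ planValue s
    planValue-step s = sup-affine-≤ (miss-nonNegative (proj₁ s)) (planValue-isSup (tail s))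
      (λ m → ≤sup (planValue-isSup s) (suc m))

    planValue≤value : ∀ {c Y} s → CanMove G c (proj₁ s) → Guaranteed c p Y → planValue s ≤ Y
    planValue≤value s move Y-ub = sup≤ (planValue-isSup s) (λ m →
      ≤-trans (planWin≤winWithin s move m []) (winWithin≤value (follow s move) m Y-ub))

    -- Standing still reproduces the same situation after a miss, so `V` is at least
    -- `hit u + miss u * V`; replacing `miss u` by the complement of `prob p u + hit u` gives the
    -- odds `hit u / (prob p u + hit u)`, free of division.
    hit≤planValue-stay : ∀ u → hit u ≤ planValue (stay u) * (prob p u + hit u)
    hit≤planValue-stay u = +-cancelʳ-≤ (miss u * V) (begin
      hit u + miss u * V                        ≤⟨ planValue-step (stay u) ⟩
      V                                         ≈⟨ *-identityʳ V ⟨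
      V * 1#                                    ≈⟨ *-congˡ (total-split u) ⟨
      V * (prob p u + hit u + miss u)
        ≈⟨ solve 4 (λ V a h m → V :* (a :+ h :+ m) := V :* (a :+ h) :+ m :* V) refl V (prob p u) (hit u) (miss u) ⟩
      V * (prob p u + hit u) + miss u * V       ∎)
      where V = planValue (stay u)

    prob+hit-nonNegative : ∀ u → 0# ≤ prob p u + hit u
    prob+hit-nonNegative u = +-nonNegative (nonNegative p u) (hit-nonNegative u)

    hit≤value : ∀ {c Y u} → CanMove G c u → Guaranteed c p Y → hit u ≤ Y * (prob p u + hit u)
    hit≤value {u = u} move Y-ub = ≤-trans (hit≤planValue-stay u)
      (*-monoʳ-≤ (prob+hit-nonNegative u) (planValue≤value (stay u) move Y-ub))

    -- `V * (1# + R) ≤ R` says that `V` is at most `R / (1 + R)`, and the odds `h / (a + h)` are at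
    -- most `R / (1 + R)` exactly when `h ≤ R * a`.
    hit≤ratio : ∀ {V R u} → 0# ≤ R → V * (1# + R) ≤ R → hit u ≤ V * (prob p u + hit u) →
                hit u ≤ R * prob p u
    hit≤ratio {V} {R} {u} 0≤R V≤ hit≤ = +-cancelʳ-≤ (R * h) (begin
      h + R * h                    ≈⟨ solve 2 (λ h R → h :+ R :* h := (con 1 :+ R) :* h) refl h R ⟩
      (1# + R) * h                 ≤⟨ *-monoˡ-≤ (+-nonNegative 0≤1 0≤R) hit≤ ⟩
      (1# + R) * (V * (a + h))     ≈⟨ solve 4 (λ V R a h → (con 1 :+ R) :* (V :* (a :+ h)) := (V :* (con 1 :+ R)) :* (a :+ h)) refl V R a h ⟩
      (V * (1# + R)) * (a + h)     ≤⟨ *-monoʳ-≤ (prob+hit-nonNegative u) V≤ ⟩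
      R * (a + h)                  ≈⟨ distribˡ R a h ⟩
      R * a + R * h                ∎)
      where
      a = prob p u
      h = hit u

    -- Crossing vertices of probability zero carries no risk. The walk is cut just before its first
    -- vertex of positive probability; there `hit u` is positive and `prob p u` vanishes, so
    -- standing still wins almost surely.
    walk-to-support : ∀ {u v} → Star _~_ u v → prob p u ≤ 0# → ¬ (prob p v ≤ 0#) →
                      ∃ λ w → Σ (Star _~_ u w) λ π → 1# ≤ planValue (u , w , π)
    walk-to-support ε u≤0 v≰0 = contradiction u≤0 v≰0
    walk-to-support {u} {v} (_◅_ {j = w} u~w π) u≤0 v≰0 with prob p w ≤? 0#
    ... | yes w≤0 = let x , π′ , 1≤V = walk-to-support π w≤0 v≰0 in
      x , u~w ◅ π′ , (begin
        1#                                ≈⟨ total-split u ⟨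
        prob p u + hit u + miss u         ≤⟨ +-monoˡ-≤ (miss u) (+-monoˡ-≤ (hit u) u≤0) ⟩
        0# + hit u + miss u               ≈⟨ solve 2 (λ h m → con 0 :+ h :+ m := h :+ m :* con 1) refl (hit u) (miss u) ⟩
        hit u + miss u * 1#               ≤⟨ +-monoʳ-≤ (hit u) (*-monoˡ-≤ (miss-nonNegative u) 1≤V) ⟩
        hit u + miss u * planValue (w , x , π′)  ≤⟨ planValue-step (u , x , u~w ◅ π′) ⟩
        planValue (u , x , u~w ◅ π′)      ∎)
    ... | no w≰0 = u , ε , *-cancelˡ-≤ {z = hit u} hit≰0 (begin
      hit u * 1#                              ≈⟨ *-identityʳ (hit u) ⟩
      hit u                                   ≤⟨ hit≤planValue-stay u ⟩
      V * (prob p u + hit u)                  ≤⟨ *-monoˡ-≤ (planValue-nonNegative (stay u)) (+-monoˡ-≤ (hit u) u≤0) ⟩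
      V * (0# + hit u)                        ≈⟨ solve 2 (λ V h → V :* (con 0 :+ h) := h :* V) refl V (hit u) ⟩
      hit u * V                               ∎)
      where
      V = planValue (stay u)
      hit≰0 : ¬ (hit u ≤ 0#)
      hit≰0 hit≤0 = w≰0 (≤-trans (single≤neighbourSum (nonNegative p) u~w) hit≤0)

    support : ∃ λ v → ¬ (prob p v ≤ 0#)
    support with any? (λ v → ¬? (prob p v ≤? 0#))
    ... | yes found = found
    ... | no none = ⊥-elim (1≰0 (begin
      1#                  ≈⟨ total p ⟨
      sum (prob p)        ≤⟨ sum-mono-≤ (λ v → all≤0 v) ⟩
      sum {n} (λ _ → 0#)  ≈⟨ sum-replicate-zero n ⟩
      0#                  ∎))
      where
      all≤0 : ∀ v → prob p v ≤ 0#
      all≤0 v with prob p v ≤? 0#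
      ... | yes v≤0 = v≤0
      ... | no v≰0 = contradiction (v , v≰0) none

    -- Consequences of a cop value of at most `R / (1 + R)` from the start `z`.

    module Bounded (connected : Connected G) {z : Fin n} {Y R : Carrier} (0≤R : 0# ≤ R)
                   (Y-ub : Guaranteed z p Y) (Y≤ : Y * (1# + R) ≤ R) where

      start-positive : ¬ (prob p z ≤ 0#)
      start-positive z≤0 =
        let v , v≰0 = support
            w , π , 1≤V = walk-to-support (connected z v) z≤0 v≰0
            1≤Y = ≤-trans 1≤V (planValue≤value (z , w , π) (inj₁ ≡.refl) Y-ub)
        in x+1≰x (begin
          R + 1#        ≈⟨ solve 1 (λ R → R :+ con 1 := con 1 :* (con 1 :+ R)) refl R ⟩
          1# * (1# + R) ≤⟨ *-monoʳ-≤ (+-nonNegative 0≤1 0≤R) 1≤Y ⟩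
          Y * (1# + R)  ≤⟨ Y≤ ⟩
          R             ∎)

      hit≤ : ∀ {u} → CanMove G z u → hit u ≤ R * prob p u
      hit≤ move = hit≤ratio 0≤R Y≤ (hit≤value move Y-ub)

      -- The start is itself a neighbour of `w`, so its probability is part of `hit w`.
      start≤neighbour : ∀ {w} → z ~ w → prob p z ≤ R * prob p w
      start≤neighbour z~w =
        ≤-trans (single≤neighbourSum (nonNegative p) (~-sym z~w)) (hit≤ (inj₂ z~w))

      neighbourSum-scale : neighbourSum z (λ k → R * prob p k) ≈ R * hit z
      neighbourSum-scale = trans
        (sum-cong-≋ (λ k → solve 3 (λ i R x → i :* (R :* x) := R :* (i :* x)) refl (𝟙 (z ~? k)) R (prob p k)))
        (sym (*-distribˡ-sum R (λ k → 𝟙 (z ~? k) * prob p k)))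

      degree≤ : neighbourSum z (λ _ → 1#) * prob p z ≤ R * hit z
      degree≤ = begin
        neighbourSum z (λ _ → 1#) * prob p z      ≈⟨ neighbourSum-const z (λ _ _ → refl) ⟨
        neighbourSum z (λ _ → prob p z)           ≤⟨ sum-mono-≤ pointwise ⟩
        neighbourSum z (λ k → R * prob p k)       ≈⟨ neighbourSum-scale ⟩
        R * hit z                                 ∎
        where
        pointwise : ∀ k → 𝟙 (z ~? k) * prob p z ≤ 𝟙 (z ~? k) * (R * prob p k)
        pointwise k with z ~? k
        ... | yes z~k = *-monoˡ-≤ 0≤1 (start≤neighbour z~k)
        ... | no _    = ≤-reflexive (trans (zeroˡ _) (sym (zeroˡ _)))

      -- In the sum of `R * prob p k` over the neighbours, at most `R * R * prob p z`, each
      -- neighbour other than `w` contributes at least `prob p z`. What is left caps `prob p w` from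
      -- above, complementing `start≤neighbour`.
      neighbour≤ : ∀ {w} → z ~ w →
                   neighbourSum z (λ _ → 1#) * prob p z + R * prob p w ≤ R * (R * prob p z) + prob p z
      neighbour≤ {w} z~w = begin
        neighbourSum z (λ _ → 1#) * prob p z + R * prob p w
          ≤⟨ neighbourSum-replace z~w (λ k z~k → start≤neighbour z~k) ⟩
        neighbourSum z (λ k → R * prob p k) + prob p z
          ≈⟨ +-congʳ neighbourSum-scale ⟩
        R * hit z + prob p z
          ≤⟨ +-monoˡ-≤ (prob p z) (*-monoˡ-≤ 0≤R (hit≤ (inj₁ ≡.refl))) ⟩
        R * (R * prob p z) + prob p z ∎

-- Relates the order of the graph to the degree of a vertex adjacent to all others. It is used in
-- both directions: for the degree of a star's centre, and for the number of vertices when a star is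
-- recognised.
suc-length-filter : ∀ {m} {A : Set} {P : A → Set} (P? : ∀ a → Dec (P a)) (f : Fin m → A) i →
                    ¬ P (f i) → (∀ j → j ≢ i → P (f j)) → suc (length (filter P? (tabulate f))) ≡ m
suc-length-filter {suc m} P? f zero ¬Pfi Pfj = ≡.cong suc (≡.trans
  (≡.cong length (≡.trans (filter-reject P? ¬Pfi)
    (filter-all P? (All.tabulate⁺ (λ j → Pfj (suc j) λ ())))))
  (length-tabulate (f ∘ suc)))
suc-length-filter P? f (suc i) ¬Pfi Pfj = ≡.cong suc (≡.trans
  (≡.cong length (filter-accept P? (Pfj zero λ ())))
  (suc-length-filter P? (f ∘ suc) i ¬Pfi (λ j j≢i → Pfj (suc j) (j≢i ∘ Fin.suc-injective))))

-- Stars: the optimal distribution and the value of the game.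

module StarCharacterisation {ℓ : Level} (ℝ : RealField ℓ) {n : ℕ} (G : Graph n) (d : ℕ)
                            (connected : Connected G)
                            (r : RealField.Carrier ℝ) (√d : RealField.IsSqrt ℝ d r) where
  open RealField ℝ
  open RealFieldProperties ℝ
  open ≤-Reasoning
  open Graph G using (_~_; _~?_; irrefl) renaming (sym to ~-sym)
  open Game G ℝ
  open GameProperties ℝ G

  0≤r : 0# ≤ r
  0≤r = proj₁ √d

  r²≈d : r * r ≈ d · 1#
  r²≈d = proj₂ √d

  1+r≉0 : ¬ (1# + r ≈ 0#)
  1+r≉0 = ≰0⇒≉0 (1+-positive 0≤r)

  centre : Carrier
  centre = (1# + r) ⁻¹

  0≤centre : 0# ≤ centre
  0≤centre = ⁻¹-nonNegative (1+-positive 0≤r)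

  centre+bound≈1 : centre + bound r ≈ 1#
  centre+bound≈1 = begin-equality
    centre + r * centre   ≈⟨ solve 2 (λ a r → a :+ r :* a := (con 1 :+ r) :* a) refl centre r ⟩
    (1# + r) * centre     ≈⟨ *-inverseʳ _ 1+r≉0 ⟩
    1#                    ∎

  0≤bound : 0# ≤ bound r
  0≤bound = *-nonNegative 0≤r 0≤centre

  bound-scaled : bound r * (1# + r) ≈ r
  bound-scaled = trans (*-assoc r _ _) (trans (*-congˡ (*-inverseˡ _ 1+r≉0)) (*-identityʳ r))

  centre-unique : ∀ {a} → a + r * a ≈ 1# → a ≈ centre
  centre-unique {a} eq = begin-equality
    a                               ≈⟨ ⁻¹-*-cancel a 1+r≉0 ⟨
    centre * ((1# + r) * a)         ≈⟨ *-congˡ (solve 2 (λ a r → (con 1 :+ r) :* a := a :+ r :* a) refl a r) ⟩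
    centre * (a + r * a)            ≈⟨ *-congˡ eq ⟩
    centre * 1#                     ≈⟨ *-identityʳ centre ⟩
    centre                          ∎

  module AtStar {z : Fin n} (star : IsStar G d z) where
    n≡ = proj₁ star

    centre~ : ∀ {v} → v ≢ z → z ~ v
    centre~ {v} = proj₁ (proj₂ star) v

    leaves-nonadjacent : ∀ {u v} → u ≢ z → v ≢ z → ¬ (u ~ v)
    leaves-nonadjacent {u} {v} u≢z v≢z u~v =
      [ u≢z , v≢z ]′ (proj₂ (proj₂ star) u v u~v)

    degree≡d : degree G z ≡ d
    degree≡d = ℕ.suc-injective (≡.trans
      (suc-length-filter (z ~?_) id z (irrefl ≡.refl) (λ v → centre~)) n≡)

    degree≈r² : neighbourSum z (λ _ → 1#) ≈ r * r
    degree≈r² = trans (degree≈ degree≡d) (sym r²≈d)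

    CanMove-centre : ∀ c → CanMove G c z
    CanMove-centre c with c Fin.≟ z
    ... | yes c≡z = inj₁ c≡z
    ... | no c≢z  = inj₂ (~-sym (centre~ c≢z))

    -- Separates off the one-vertex star, where `d` and `r` are zero: any leaf makes the degree at
    -- least 1, which permits cancelling `r`.
    leaf⇒r≉0 : ∀ {u} → u ≢ z → ¬ (r ≈ 0#)
    leaf⇒r≉0 u≢z r≈0 = 1≰0 (begin
      1#                          ≤⟨ single≤neighbourSum (λ _ → 0≤1) (centre~ u≢z) ⟩
      neighbourSum z (λ _ → 1#)   ≈⟨ degree≈r² ⟩
      r * r                       ≈⟨ *-congʳ r≈0 ⟩
      0# * r                      ≈⟨ zeroˡ r ⟩
      0#                          ∎)

    module _ (p : Distribution) where
      open PlanValue p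

      prob+hit≈1 : prob p z + hit z ≈ 1#
      prob+hit≈1 = begin-equality
        prob p z + hit z            ≈⟨ +-identityʳ _ ⟨
        prob p z + hit z + 0#       ≈⟨ +-congˡ miss≈0 ⟨
        prob p z + hit z + miss z   ≈⟨ total-split z ⟩
        1#                          ∎
        where
        covered : ∀ k → k ≡ z ⊎ z ~ k
        covered k with k Fin.≟ z
        ... | yes k≡z = inj₁ k≡z
        ... | no k≢z  = inj₂ (centre~ k≢z)
        miss≈0 : miss z ≈ 0#
        miss≈0 = trans (sum-cong-≋ (λ k → trans
          (*-congʳ (𝟙-no (outside z k) (λ out → out (covered k)))) (zeroˡ (prob p k))))
          (sum-replicate-zero n)

      -- With `R = r` the estimates of `Bounded` close up, the degree being `r * r`: `hit≤` and
      -- `degree≤` give `hit z ≈ r * a`, which fixes the centre, and `start≤neighbour` and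
      -- `neighbour≤` pin every leaf to `r * prob p u ≈ a`.
      tight⇒starDistribution : ∀ {Y} → Guaranteed z p Y → Y ≤ bound r → IsStarDistribution r z p
      tight⇒starDistribution {Y} Y-ub Y≤ =
        centre-unique (trans (+-congˡ (sym hit≈)) prob+hit≈1) ,
        λ u v u≢z v≢z → *-cancelˡ-≈ (leaf⇒r≉0 u≢z) (trans (leaf≈ u≢z) (sym (leaf≈ v≢z)))
        where
        Y[1+r]≤r : Y * (1# + r) ≤ r
        Y[1+r]≤r = ≤-trans (*-monoʳ-≤ (+-nonNegative 0≤1 0≤r) Y≤) (≤-reflexive bound-scaled)
        open Bounded connected 0≤r Y-ub Y[1+r]≤r
        a = prob p z
        degree-scaled : neighbourSum z (λ _ → 1#) * a ≈ r * (r * a)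
        degree-scaled = trans (*-congʳ degree≈r²) (*-assoc r r a)
        ra≤hit : r * a ≤ hit z
        -- `degree≤` gives `r * (r * a) ≤ r * hit z`, so a factor `r` must be cancelled; when `r` is
        -- zero the claim is just nonnegativity of `hit z`.
        ra≤hit with r ≤? 0#
        ... | yes r≤0 = ≤-respˡ-≈ (sym (trans (*-congʳ (antisym r≤0 0≤r)) (zeroˡ a))) (hit-nonNegative z)
        ... | no r≰0 = *-cancelˡ-≤ r≰0 (≤-respˡ-≈ degree-scaled degree≤)
        hit≈ : hit z ≈ r * a
        hit≈ = antisym (hit≤ (inj₁ ≡.refl)) ra≤hit
        leaf≈ : ∀ {u} → u ≢ z → r * prob p u ≈ a
        leaf≈ {u} u≢z = antisym
          (+-cancelʳ-≤ (r * (r * a)) (begin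
            r * prob p u + r * (r * a)   ≈⟨ +-comm _ _ ⟩
            r * (r * a) + r * prob p u   ≈⟨ +-congʳ degree-scaled ⟨
            neighbourSum z (λ _ → 1#) * a + r * prob p u  ≤⟨ neighbour≤ (centre~ u≢z) ⟩
            r * (r * a) + a              ≈⟨ +-comm _ _ ⟩
            a + r * (r * a)              ∎))
          (start≤neighbour (centre~ u≢z))

      module _ (starDist : IsStarDistribution r z p) where
        prob-centre : prob p z ≈ centre
        prob-centre = proj₁ starDist

        hit≈bound : hit z ≈ bound r
        hit≈bound = +-cancelʳ-≈ (prob p z) (begin-equality
          hit z + prob p z    ≈⟨ +-comm _ _ ⟩
          prob p z + hit z    ≈⟨ prob+hit≈1 ⟩
          1#                  ≈⟨ centre+bound≈1 ⟨
          centre + bound r    ≈⟨ +-comm _ _ ⟩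
          bound r + centre    ≈⟨ +-congˡ prob-centre ⟨
          bound r + prob p z  ∎)

        leaf-ratio : ∀ {u} → u ≢ z → r * prob p u ≈ prob p z
        leaf-ratio {u} u≢z = *-cancelˡ-≈ (leaf⇒r≉0 u≢z) (begin-equality
          r * (r * prob p u)        ≈⟨ *-assoc r r _ ⟨
          r * r * prob p u          ≈⟨ *-congʳ degree≈r² ⟨
          neighbourSum z (λ _ → 1#) * prob p u
            ≈⟨ neighbourSum-const z (λ k z~k → proj₂ starDist k u (λ { ≡.refl → irrefl ≡.refl z~k }) u≢z) ⟨
          hit z                     ≈⟨ hit≈bound ⟩
          r * centre                ≈⟨ *-congˡ prob-centre ⟨
          r * prob p z              ∎)

        -- For a cop on the leaf `u`, a hop to `z` allows capture and a hop to `u` is fatal. The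
        -- odds `prob p z / (prob p z + prob p u)` equal `bound r`, so a leaf is worth as much as
        -- the centre.
        leaf-balance : ∀ {u} → u ≢ z → bound r * (prob p z + prob p u) ≈ prob p z
        leaf-balance {u} u≢z = begin-equality
          r * centre * (prob p z + prob p u)
            ≈⟨ solve 4 (λ r c a b → r :* c :* (a :+ b) := c :* (r :* a :+ r :* b)) refl r centre (prob p z) (prob p u) ⟩
          centre * (r * prob p z + r * prob p u)
            ≈⟨ *-congˡ (+-congˡ (leaf-ratio u≢z)) ⟩
          centre * (r * prob p z + prob p z)
            ≈⟨ solve 3 (λ r c a → c :* (r :* a :+ a) := c :* ((con 1 :+ r) :* a)) refl r centre (prob p z) ⟩
          centre * ((1# + r) * prob p z)
            ≈⟨ ⁻¹-*-cancel (prob p z) 1+r≉0 ⟩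
          prob p z ∎

        -- Induction on the number of hops. At the centre the cop loses at once with probability
        -- `centre`, the complement of `bound r`. On a leaf she gains at most 1 from a hop to `z`,
        -- nothing from a hop onto her, and at most `bound r` from any other hop by induction;
        -- `leaf-balance` makes the total `bound r`.
        winWithin≤bound : ∀ {c} (σ : Strategy G c) m h → winWithin σ p m h ≤ bound r
        winWithin≤bound σ zero    h = 0≤bound
        winWithin≤bound σ (suc m) h with position σ h Fin.≟ z
        ... | yes pos≡z = +-cancelʳ-≤ (prob p z) (begin
          winWithin σ p (suc m) h + prob p z
            ≈⟨ +-congˡ (sum-𝟙-≟ (prob p) z) ⟨
          _ ≈⟨ ∑-distrib-+ (λ k → prob p k * A k) (λ k → 𝟙 (k Fin.≟ z) * prob p k) ⟨
          sum (λ k → prob p k * A k + 𝟙 (k Fin.≟ z) * prob p k)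
            ≤⟨ sum-mono-≤ pointwise ⟩
          sum (prob p)              ≈⟨ total p ⟩
          1#                        ≈⟨ centre+bound≈1 ⟨
          centre + bound r          ≈⟨ +-comm _ _ ⟩
          bound r + centre          ≈⟨ +-congˡ prob-centre ⟨
          bound r + prob p z        ∎)
          where
          A : Fin n → Carrier
          A = afterHop σ p m h
          pointwise : ∀ k → prob p k * A k + 𝟙 (k Fin.≟ z) * prob p k ≤ prob p k
          pointwise k with k Fin.≟ z
          ... | yes ≡.refl = ≤-reflexive (begin-equality
            prob p k * A k + 1# * prob p k
              ≈⟨ +-congʳ (*-congˡ (afterHop-lost σ p m h k (≡.sym pos≡z))) ⟩
            prob p k * 0# + 1# * prob p k
              ≈⟨ solve 1 (λ x → x :* con 0 :+ con 1 :* x := x) refl (prob p k) ⟩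
            prob p k ∎)
          ... | no _ = begin
            prob p k * A k + 0# * prob p k
              ≤⟨ +-monoˡ-≤ _ (*-monoˡ-≤ (nonNegative p k) (afterHop≤1 σ p m h k)) ⟩
            prob p k * 1# + 0# * prob p k
              ≈⟨ solve 1 (λ x → x :* con 1 :+ con 0 :* x := x) refl (prob p k) ⟩
            prob p k ∎
        -- `prob p z` is added to both sides, on the left in the form given by `leaf-balance`, so
        -- that the inequality can be checked separately for each hop.
        ... | no pos≢z = +-cancelʳ-≤ (prob p z) (begin
          winWithin σ p (suc m) h + prob p z
            ≈⟨ +-congˡ (leaf-balance pos≢z) ⟨
          winWithin σ p (suc m) h + β * (prob p z + prob p u)
            ≈⟨ +-congˡ (trans (distribˡ β _ _) (+-cong (sym (sum-𝟙-≟ (λ k → β * prob p k) z)) (sym (sum-𝟙-≟ (λ k → β * prob p k) u)))) ⟩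
          _ ≈⟨ +-congˡ (∑-distrib-+ (λ k → 𝟙 (k Fin.≟ z) * (β * prob p k)) (λ k → 𝟙 (k Fin.≟ u) * (β * prob p k))) ⟨
          _ ≈⟨ ∑-distrib-+ (λ k → prob p k * A k) (λ k → 𝟙 (k Fin.≟ z) * (β * prob p k) + 𝟙 (k Fin.≟ u) * (β * prob p k)) ⟨
          sum (λ k → prob p k * A k + (𝟙 (k Fin.≟ z) * (β * prob p k) + 𝟙 (k Fin.≟ u) * (β * prob p k)))
            ≤⟨ sum-mono-≤ pointwise ⟩
          sum (λ k → β * prob p k + 𝟙 (k Fin.≟ z) * prob p k)
            ≈⟨ ∑-distrib-+ (λ k → β * prob p k) (λ k → 𝟙 (k Fin.≟ z) * prob p k) ⟩
          _ ≈⟨ +-cong (sym (*-distribˡ-sum β (prob p))) (sum-𝟙-≟ (prob p) z) ⟩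
          β * sum (prob p) + prob p z
            ≈⟨ +-congʳ (trans (*-congˡ (total p)) (*-identityʳ β)) ⟩
          β + prob p z ∎)
          where
          u = position σ h
          β = bound r
          A : Fin n → Carrier
          A = afterHop σ p m h
          stays-leaf : ∀ k → k ≢ z → k ≢ u → position σ (k ∷ h) ≢ k
          stays-leaf k k≢z k≢u pos≡k with ≡.subst (CanMove G u) pos≡k (nextMove σ k h)
          ... | inj₁ u≡k = k≢u (≡.sym u≡k)
          ... | inj₂ u~k = leaves-nonadjacent pos≢z k≢z u~k
          pointwise : ∀ k → prob p k * A k + (𝟙 (k Fin.≟ z) * (β * prob p k) + 𝟙 (k Fin.≟ u) * (β * prob p k))
                          ≤ β * prob p k + 𝟙 (k Fin.≟ z) * prob p k
          pointwise k = by-cases (k Fin.≟ z) (k Fin.≟ u)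
            where
            x = prob p k
            by-cases : (k≟z : Dec (k ≡ z)) (k≟u : Dec (k ≡ u)) →
                       x * A k + (𝟙 k≟z * (β * x) + 𝟙 k≟u * (β * x)) ≤ β * x + 𝟙 k≟z * x
            by-cases (yes ≡.refl) (yes z≡u) = contradiction (≡.sym z≡u) pos≢z
            by-cases (yes ≡.refl) (no _) = begin
              x * A k + (1# * (β * x) + 0# * (β * x))
                ≤⟨ +-monoˡ-≤ _ (*-monoˡ-≤ (nonNegative p k) (afterHop≤1 σ p m h k)) ⟩
              x * 1# + (1# * (β * x) + 0# * (β * x))
                ≈⟨ solve 2 (λ x b → x :* con 1 :+ (con 1 :* (b :* x) :+ con 0 :* (b :* x)) := b :* x :+ con 1 :* x) refl x β ⟩
              β * x + 1# * x ∎
            by-cases (no _) (yes k≡u) = ≤-reflexive (begin-equality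
              x * A k + (0# * (β * x) + 1# * (β * x))
                ≈⟨ +-congʳ (*-congˡ (afterHop-lost σ p m h k k≡u)) ⟩
              x * 0# + (0# * (β * x) + 1# * (β * x))
                ≈⟨ solve 2 (λ x b → x :* con 0 :+ (con 0 :* (b :* x) :+ con 1 :* (b :* x)) := b :* x :+ con 0 :* x) refl x β ⟩
              β * x + 0# * x ∎)
            by-cases (no k≢z) (no k≢u) = begin
              x * A k + (0# * (β * x) + 0# * (β * x))
                ≤⟨ +-monoˡ-≤ _ (*-monoˡ-≤ (nonNegative p k) (afterHop-≤ σ p m h k 0≤bound
                     (λ _ pos≡k → contradiction pos≡k (stays-leaf k k≢z k≢u))
                     (λ _ → winWithin≤bound σ m (k ∷ h)))) ⟩
              x * β + (0# * (β * x) + 0# * (β * x))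
                ≈⟨ solve 2 (λ x b → x :* b :+ (con 0 :* (b :* x) :+ con 0 :* (b :* x)) := b :* x :+ con 0 :* x) refl x β ⟩
              β * x + 0# * x ∎

        -- The cop can be at the centre before the first hop, and that hop alone lands on a leaf
        -- with probability `bound r`.
        bound≤value : ∀ {c b} → Guaranteed c p b → bound r ≤ b
        bound≤value {c} {b} ub = begin
          bound r                               ≈⟨ hit≈bound ⟨
          hit z                                 ≤⟨ x≤x+y (*-nonNegative (miss-nonNegative z) (planValue-nonNegative (stay z))) ⟩
          hit z + miss z * planValue (stay z)   ≤⟨ planValue-step (stay z) ⟩
          planValue (stay z)                    ≤⟨ planValue≤value (stay z) (CanMove-centre c) ub ⟩
          b                                     ∎

        copValue : ∀ c → CopValue c p (bound r)
        copValue c = (λ { (σ , sup) → winProbability≤ σ p (λ m → winWithin≤bound σ m []) sup }) , bound≤value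

    starDistribution : ∃ (IsStarDistribution r z)
    starDistribution = p , prob-z , λ u v u≢z v≢z → trans (prob-leaf u≢z) (sym (prob-leaf v≢z))
      where
      -- The `d` leaves must share `bound r`, so each gets `centre / r`. If `r` is zero there are no
      -- leaves and `0#` serves.
      leaf-exists : ∃ λ t → 0# ≤ t × r * r * t ≈ bound r
      leaf-exists with r ≤? 0#
      ... | yes r≤0 = 0# , ≤-refl , trans (zeroʳ _) (sym (trans (*-congʳ (antisym r≤0 0≤r)) (zeroˡ centre)))
      ... | no r≰0 = r ⁻¹ * centre , *-nonNegative (⁻¹-nonNegative r≰0) 0≤centre , (begin-equality
        r * r * (r ⁻¹ * centre)    ≈⟨ solve 3 (λ r s c → r :* r :* (s :* c) := r :* (s :* (r :* c))) refl r (r ⁻¹) centre ⟩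
        r * (r ⁻¹ * (r * centre))  ≈⟨ *-congˡ (⁻¹-*-cancel centre (≰0⇒≉0 r≰0)) ⟩
        r * centre                 ∎)
      t = proj₁ leaf-exists
      weight : Fin n → Carrier
      weight k = 𝟙 (k Fin.≟ z) * centre + 𝟙 (z ~? k) * t
      p : Distribution
      p = record
        { prob = weight
        ; nonNegative = λ k → +-nonNegative
            (*-nonNegative (𝟙-nonNegative (k Fin.≟ z)) 0≤centre)
            (*-nonNegative (𝟙-nonNegative (z ~? k)) (proj₁ (proj₂ leaf-exists)))
        ; total = begin-equality
            sum weight
              ≈⟨ ∑-distrib-+ (λ k → 𝟙 (k Fin.≟ z) * centre) (λ k → 𝟙 (z ~? k) * t) ⟩
            _ ≈⟨ +-cong (sum-𝟙-≟ (λ _ → centre) z) (neighbourSum-const z (λ _ _ → refl)) ⟩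
            centre + neighbourSum z (λ _ → 1#) * t
              ≈⟨ +-congˡ (trans (*-congʳ degree≈r²) (proj₂ (proj₂ leaf-exists))) ⟩
            centre + bound r   ≈⟨ centre+bound≈1 ⟩
            1# ∎
        }
      prob-z : weight z ≈ centre
      prob-z = begin-equality
        weight z                   ≈⟨ +-cong (*-congʳ (𝟙-yes (z Fin.≟ z) ≡.refl)) (*-congʳ (𝟙-no (z ~? z) (irrefl ≡.refl))) ⟩
        1# * centre + 0# * t       ≈⟨ solve 2 (λ c t → con 1 :* c :+ con 0 :* t := c) refl centre t ⟩
        centre                     ∎
      prob-leaf : ∀ {u} → u ≢ z → weight u ≈ t
      prob-leaf {u} u≢z = begin-equality
        weight u                   ≈⟨ +-cong (*-congʳ (𝟙-no (u Fin.≟ z) u≢z)) (*-congʳ (𝟙-yes (z ~? u) (centre~ u≢z))) ⟩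
        0# * centre + 1# * t       ≈⟨ solve 2 (λ c t → con 0 :* c :+ con 1 :* t := t) refl centre t ⟩
        t                          ∎

    copValue⇔starDistribution : ∀ p → CopValue z p (bound r) ⇔ IsStarDistribution r z p
    copValue⇔starDistribution p = mk⇔
      (λ { (ub , _) → tight⇒starDistribution p ub ≤-refl })
      (λ starDist → copValue p starDist z)

    -- No minimisation over distributions is carried out: a value of at most `bound r` already
    -- forces the star distribution, whose value is known.
    bound≤copValue : ∀ {p Y} → Guaranteed z p Y → bound r ≤ Y
    bound≤copValue {p} {Y} ub with ≤-total (bound r) Y
    ... | inj₁ le = le
    ... | inj₂ Y≤ = bound≤value p (tight⇒starDistribution p ub Y≤) ub

    -- The star distribution holds the cop to `bound r` from every start, and from the centre no
    -- distribution holds her to less.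
    gameValue : GameValue (bound r)
    gameValue =
        (λ { (c , lb , _) → lb (proj₁ starDistribution , copValue _ (proj₂ starDistribution) c) })
      , (λ ub → ub (z , (λ { (p , ub′ , _) → bound≤copValue ub′ })
                      , (λ lb → lb (proj₁ starDistribution , copValue _ (proj₂ starDistribution) z))))

-- Graphs that are not stars: a uniform gap above the bound.

module NonStar {ℓ : Level} (ℝ : RealField ℓ) {n : ℕ} (G : Graph n) (d : ℕ)
               (connected : Connected G) (maxDegree : HasMaxDegree G d)
               (r : RealField.Carrier ℝ) (√d : RealField.IsSqrt ℝ d r) where
  open RealField ℝ
  open RealFieldProperties ℝ
  open ≤-Reasoning
  open Graph G using (_~_; _~?_; irrefl) renaming (sym to ~-sym)
  open Game G ℝ
  open GameProperties ℝ G
  open StarCharacterisation ℝ G d connected r √d using (0≤r; r²≈d; bound-scaled)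

  -- The coefficient of `η` in the final inequality of `not-nearly-tight`.
  growth : Carrier → Carrier
  growth R = R * R * (R + r * r) + (1# + R)

  growth-nonNegative : ∀ {R} → 0# ≤ R → 0# ≤ growth R
  growth-nonNegative 0≤R = +-nonNegative
    (*-nonNegative (*-nonNegative 0≤R 0≤R) (+-nonNegative 0≤R (*-nonNegative 0≤r 0≤r)))
    (+-nonNegative 0≤1 0≤R)

  growth-mono-≤ : ∀ {R S} → 0# ≤ R → R ≤ S → growth R ≤ growth S
  growth-mono-≤ 0≤R R≤S = +-mono-≤
    (*-mono-≤ (*-nonNegative 0≤S 0≤S) (+-nonNegative 0≤R (*-nonNegative 0≤r 0≤r))
      (*-mono-≤ 0≤S 0≤R R≤S R≤S) (+-monoˡ-≤ _ R≤S))
    (+-monoʳ-≤ 1# R≤S)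
    where 0≤S = ≤-trans 0≤R R≤S

  module Margin where
    -- `η` is the excess of `R * R` over `r * r`. As `δ ≤ 1`, both `r + r + δ` and `growth R` are
    -- bounded by their values at `δ = 1`, whence `η * growth R ≤ δ * M`; the choice
    -- `δ = 1 / (1 + M)` keeps this below 1 and depends on `r` alone.
    M K δ R η : Carrier
    M = (r + r + 1#) * growth (r + 1#)
    K = 1# + M
    δ = K ⁻¹
    R = r + δ
    η = δ * (r + r + δ)

    0≤M : 0# ≤ M
    0≤M = *-nonNegative (+-nonNegative (+-nonNegative 0≤r 0≤r) 0≤1)
                        (growth-nonNegative (+-nonNegative 0≤r 0≤1))

    δ+δM≈1 : δ + δ * M ≈ 1#
    δ+δM≈1 = trans (solve 2 (λ δ M → δ :+ δ :* M := δ :* (con 1 :+ M)) refl δ M)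
                   (*-inverseˡ K (≰0⇒≉0 (1+-positive 0≤M)))

    0≤δ : 0# ≤ δ
    0≤δ = ⁻¹-nonNegative (1+-positive 0≤M)

    δ≰0 : ¬ (δ ≤ 0#)
    δ≰0 δ≤0 = 1≰0 (begin
      1#            ≈⟨ *-inverseˡ K (≰0⇒≉0 (1+-positive 0≤M)) ⟨
      δ * K         ≤⟨ *-monoʳ-≤ (+-nonNegative 0≤1 0≤M) δ≤0 ⟩
      0# * K        ≈⟨ zeroˡ K ⟩
      0#            ∎)

    δ≤1 : δ ≤ 1#
    δ≤1 = ≤-trans (x≤x+y (*-nonNegative 0≤δ 0≤M)) (≤-reflexive δ+δM≈1)

    0≤R : 0# ≤ R
    0≤R = +-nonNegative 0≤r 0≤δ

    0≤η : 0# ≤ η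
    0≤η = *-nonNegative 0≤δ (+-nonNegative (+-nonNegative 0≤r 0≤r) 0≤δ)

    R²≈r²+η : R * R ≈ r * r + η
    R²≈r²+η = solve 2 (λ r δ → (r :+ δ) :* (r :+ δ) := r :* r :+ δ :* (r :+ r :+ δ)) refl r δ

    η-small : ¬ (1# ≤ η * growth R)
    η-small 1≤ = δ≰0 (+-cancelʳ-≤ (δ * M) (begin
      δ + δ * M                   ≈⟨ δ+δM≈1 ⟩
      1#                          ≤⟨ 1≤ ⟩
      δ * (r + r + δ) * growth R  ≈⟨ *-assoc δ _ _ ⟩
      δ * ((r + r + δ) * growth R)
        ≤⟨ *-monoˡ-≤ 0≤δ (*-mono-≤ (+-nonNegative (+-nonNegative 0≤r 0≤r) 0≤1) (growth-nonNegative 0≤R)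
             (+-monoʳ-≤ _ δ≤1) (growth-mono-≤ 0≤R (+-monoʳ-≤ r δ≤1))) ⟩
      δ * M                       ≈⟨ +-identityˡ _ ⟨
      0# + δ * M                  ∎))

    improvedBound : Carrier
    improvedBound = R * (1# + R) ⁻¹

    -- Cross-multiplied, the inequality reads `R * (1# + r) ≤ r * (1# + R)`, that is `δ ≤ 0#`.
    improvedBound≰bound : ¬ (improvedBound ≤ bound r)
    improvedBound≰bound le = δ≰0 (+-cancelʳ-≤ (r + r * R) (begin
      δ + (r + r * R)                ≈⟨ solve 3 (λ r δ R → δ :+ (r :+ r :* R) := (r :+ δ) :+ r :* R) refl r δ R ⟩
      R + r * R                      ≈⟨ solve 2 (λ r R → R :+ r :* R := R :* (con 1 :+ r)) refl r R ⟩
      R * (1# + r)                   ≈⟨ *-congʳ scaled ⟨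
      improvedBound * (1# + R) * (1# + r)
        ≤⟨ *-monoʳ-≤ 0≤1+r (*-monoʳ-≤ (+-nonNegative 0≤1 0≤R) le) ⟩
      bound r * (1# + R) * (1# + r)  ≈⟨ solve 3 (λ b R r → b :* (con 1 :+ R) :* (con 1 :+ r) := b :* (con 1 :+ r) :* (con 1 :+ R)) refl (bound r) R r ⟩
      bound r * (1# + r) * (1# + R)  ≈⟨ *-congʳ bound-scaled ⟩
      r * (1# + R)                   ≈⟨ solve 2 (λ r R → r :* (con 1 :+ R) := con 0 :+ (r :+ r :* R)) refl r R ⟩
      0# + (r + r * R)               ∎))
      where
      0≤1+r = +-nonNegative 0≤1 0≤r
      scaled : improvedBound * (1# + R) ≈ R
      scaled = trans (*-assoc R _ _) (trans
        (*-congˡ (*-inverseˡ _ (≰0⇒≉0 (1+-positive 0≤R)))) (*-identityʳ R))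

  open Margin

  -- Besides staying at z or w, the cop may go from w to x and stay there: near
  -- tightness makes p x tiny against p w, so at x she almost surely wins, while
  -- passing through w is less risky than standing at z because d ≥ 2.
  module _ {z w x : Fin n} (deg≡d : degree G z ≡ d) (z~w : z ~ w) (w~x : w ~ x) (z≢x : z ≢ x) where

    not-nearly-tight : ∀ {p Y} → Guaranteed z p Y → ¬ (Y * (1# + R) ≤ R)
    not-nearly-tight {p} {Y} Y-ub Y≤ = η-small (+-cancelʳ-≤ (1# + rest) (begin
      1# + (1# + rest)        ≈⟨ +-assoc 1# 1# rest ⟨
      1# + 1# + rest          ≤⟨ +-monoˡ-≤ rest (≤-respʳ-≈ (sym r²≈d)
                                   (two-neighbours maxDegree (~-sym z~w) w~x z≢x)) ⟩
      r * r + rest            ≈⟨ solve 2 (λ D R → D :+ (R :+ (R :+ D) :* R) := (con 1 :+ R) :* (R :+ D)) refl (r * r) R ⟩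
      (1# + R) * T            ≤⟨ *-monoˡ-≤ 0≤1+R T≤ ⟩
      -- The factor `1# + R` lets `Y * (1# + R) ≤ R` eliminate `Y`. The right side then exceeds
      -- `1# + rest` by `η * growth R`, while `2 ≤ d` made the left side exceed it by 1.
      (1# + R) * (T * (Y * (1# + ρ)) + (1# + η))
        ≈⟨ solve 5 (λ R T Y ρ η → (con 1 :+ R) :* (T :* (Y :* (con 1 :+ ρ)) :+ (con 1 :+ η))
                               := Y :* (con 1 :+ R) :* (T :* (con 1 :+ ρ)) :+ (con 1 :+ R) :* (con 1 :+ η)) refl R T Y ρ η ⟩
      Y * (1# + R) * (T * (1# + ρ)) + (1# + R) * (1# + η)
        ≤⟨ +-monoˡ-≤ _ (*-monoʳ-≤ (*-nonNegative 0≤T 0≤1+ρ) Y≤) ⟩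
      R * (T * (1# + ρ)) + (1# + R) * (1# + η)
        ≈⟨ solve 3 (λ R D η → R :* ((R :+ D) :* (con 1 :+ η :* R)) :+ (con 1 :+ R) :* (con 1 :+ η)
                           := η :* (R :* R :* (R :+ D) :+ (con 1 :+ R)) :+ (con 1 :+ (R :+ (R :+ D) :* R))) refl R (r * r) η ⟩
      η * growth R + (1# + rest) ∎))
      where
      open PlanValue p
      open Bounded connected 0≤R Y-ub Y≤
      a = prob p z
      b = prob p w
      c = prob p x
      -- For `R = r` this is the reciprocal of the leaf probability in the star distribution;
      -- `Tb≤1+η` bounds `b` against it up to the factor `1# + η`.
      T = R + r * r
      ρ = η * R
      rest = R + T * R
      V = planValue (stay x)
      0≤T = +-nonNegative 0≤R (*-nonNegative 0≤r 0≤r)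
      0≤ρ = *-nonNegative 0≤η 0≤R
      0≤1+ρ = +-nonNegative 0≤1 0≤ρ
      0≤1+R = +-nonNegative 0≤1 0≤R

      degree≈r² : neighbourSum z (λ _ → 1#) ≈ r * r
      degree≈r² = trans (degree≈ deg≡d) (sym r²≈d)

      Rb≤ : R * b ≤ a + η * a
      Rb≤ = +-cancelʳ-≤ (r * r * a) (begin
        R * b + r * r * a       ≈⟨ +-comm _ _ ⟩
        r * r * a + R * b       ≈⟨ +-congʳ (*-congʳ degree≈r²) ⟨
        neighbourSum z (λ _ → 1#) * a + R * b  ≤⟨ neighbour≤ z~w ⟩
        R * (R * a) + a         ≈⟨ +-congʳ (*-assoc R R a) ⟨
        R * R * a + a           ≈⟨ +-congʳ (*-congʳ R²≈r²+η) ⟩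
        (r * r + η) * a + a     ≈⟨ solve 3 (λ D η a → (D :+ η) :* a :+ a := a :+ η :* a :+ D :* a) refl (r * r) η a ⟩
        a + η * a + r * r * a   ∎)

      -- Both `z` and `x` are neighbours of `w`, so `a + c ≤ hit w ≤ R * b`. Since `Rb≤` leaves room
      -- for only `η * a` beyond `a`, the probability of `x` fits into that gap.
      c≤ρb : c ≤ ρ * b
      c≤ρb = begin
        c            ≤⟨ +-cancelʳ-≤ a (begin
          c + a            ≈⟨ +-comm c a ⟩
          a + c            ≤⟨ pair≤neighbourSum (nonNegative p) (~-sym z~w) w~x z≢x ⟩
          hit w            ≤⟨ hit≤ (inj₂ z~w) ⟩
          R * b            ≤⟨ Rb≤ ⟩
          a + η * a        ≈⟨ +-comm _ _ ⟩
          η * a + a        ∎) ⟩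
        η * a        ≤⟨ *-monoˡ-≤ 0≤η (start≤neighbour z~w) ⟩
        η * (R * b)  ≈⟨ *-assoc η R b ⟨
        ρ * b        ∎

      R≰0 : ¬ (R ≤ 0#)
      R≰0 R≤0 = start-positive (begin
        a         ≤⟨ start≤neighbour z~w ⟩
        R * b     ≤⟨ *-monoʳ-≤ (nonNegative p w) R≤0 ⟩
        0# * b    ≈⟨ zeroˡ b ⟩
        0#        ∎)

      b≤hit : b ≤ hit x
      b≤hit = single≤neighbourSum (nonNegative p) (~-sym w~x)

      hit≰0 : ¬ (hit x ≤ 0#)
      hit≰0 hit≤0 = start-positive (begin
        a         ≤⟨ start≤neighbour z~w ⟩
        R * b     ≤⟨ *-monoˡ-≤ 0≤R (≤-trans b≤hit hit≤0) ⟩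
        R * 0#    ≈⟨ zeroʳ R ⟩
        0#        ∎)

      -- Standing at `x`, the losing probability `c` is at most `ρ` times the winning probability,
      -- because `w` is among the neighbours of `x`.
      1≤V[1+ρ] : 1# ≤ V * (1# + ρ)
      1≤V[1+ρ] = *-cancelˡ-≤ hit≰0 (begin
        hit x * 1#                  ≈⟨ *-identityʳ _ ⟩
        hit x                       ≤⟨ hit≤planValue-stay x ⟩
        V * (c + hit x)             ≤⟨ *-monoˡ-≤ (planValue-nonNegative (stay x)) (+-monoˡ-≤ (hit x)
                                         (≤-trans c≤ρb (*-monoˡ-≤ 0≤ρ b≤hit))) ⟩
        V * (ρ * hit x + hit x)     ≈⟨ solve 3 (λ V ρ h → V :* (ρ :* h :+ h) := h :* (V :* (con 1 :+ ρ))) refl V ρ (hit x) ⟩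
        hit x * (V * (1# + ρ))      ∎)

      -- Pausing at `w` loses only with probability `b`; every other hop wins at once or leads to
      -- `x`, where the value is at least `1 / (1 + ρ)`.
      1≤b+Y[1+ρ] : 1# ≤ b + Y * (1# + ρ)
      1≤b+Y[1+ρ] = begin
        1#                              ≈⟨ total-split w ⟨
        b + hit w + miss w              ≈⟨ solve 3 (λ b h m → b :+ h :+ m := b :+ (h :+ m) :* con 1) refl b (hit w) (miss w) ⟩
        b + (hit w + miss w) * 1#       ≤⟨ +-monoʳ-≤ b (*-monoˡ-≤ (+-nonNegative (hit-nonNegative w) (miss-nonNegative w)) 1≤V[1+ρ]) ⟩
        b + (hit w + miss w) * (V * (1# + ρ))
          ≈⟨ solve 5 (λ b h m V ρ → b :+ (h :+ m) :* (V :* (con 1 :+ ρ)) := b :+ (h :* V :+ m :* V) :* (con 1 :+ ρ)) refl b (hit w) (miss w) V ρ ⟩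
        b + (hit w * V + miss w * V) * (1# + ρ)
          ≤⟨ +-monoʳ-≤ b (*-monoʳ-≤ 0≤1+ρ (+-monoˡ-≤ _ (*-monoˡ-≤ (hit-nonNegative w) (planValue≤1 (stay x))))) ⟩
        b + (hit w * 1# + miss w * V) * (1# + ρ)
          ≈⟨ +-congˡ (*-congʳ (+-congʳ (*-identityʳ (hit w)))) ⟩
        b + (hit w + miss w * V) * (1# + ρ)
          ≤⟨ +-monoʳ-≤ b (*-monoʳ-≤ 0≤1+ρ (≤-trans (planValue-step through-w) (planValue≤value through-w (inj₂ z~w) Y-ub))) ⟩
        b + Y * (1# + ρ)                ∎
        where
        through-w : Plan
        through-w = w , x , w~x ◅ ε

      Ta≤R : T * a ≤ R
      Ta≤R = begin
        T * a                    ≈⟨ distribʳ a R (r * r) ⟩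
        R * a + r * r * a        ≈⟨ +-congˡ (*-congʳ degree≈r²) ⟨
        R * a + neighbourSum z (λ _ → 1#) * a  ≤⟨ +-monoʳ-≤ _ degree≤ ⟩
        R * a + R * hit z        ≈⟨ distribˡ R a (hit z) ⟨
        R * (a + hit z)          ≤⟨ *-monoˡ-≤ 0≤R (prob+hit≤1 z) ⟩
        R * 1#                   ≈⟨ *-identityʳ R ⟩
        R                        ∎

      Tb≤1+η : T * b ≤ 1# + η
      Tb≤1+η = *-cancelˡ-≤ R≰0 (begin
        R * (T * b)              ≈⟨ solve 3 (λ R T b → R :* (T :* b) := T :* (R :* b)) refl R T b ⟩
        T * (R * b)              ≤⟨ *-monoˡ-≤ 0≤T Rb≤ ⟩
        T * (a + η * a)          ≈⟨ solve 3 (λ T a η → T :* (a :+ η :* a) := T :* a :* (con 1 :+ η)) refl T a η ⟩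
        T * a * (1# + η)         ≤⟨ *-monoʳ-≤ (+-nonNegative 0≤1 0≤η) Ta≤R ⟩
        R * (1# + η)             ∎)

      T≤ : T ≤ T * (Y * (1# + ρ)) + (1# + η)
      T≤ = begin
        T                               ≈⟨ *-identityʳ T ⟨
        T * 1#                          ≤⟨ *-monoˡ-≤ 0≤T 1≤b+Y[1+ρ] ⟩
        T * (b + Y * (1# + ρ))          ≈⟨ solve 3 (λ T b y → T :* (b :+ y) := T :* y :+ T :* b) refl T b (Y * (1# + ρ)) ⟩
        T * (Y * (1# + ρ)) + T * b      ≤⟨ +-monoʳ-≤ _ Tb≤1+η ⟩
        T * (Y * (1# + ρ)) + (1# + η)   ∎

    -- `improvedBound` does not depend on `p`, so the gap survives the infimum over distributions.
    improvedBound≤value : ∀ {p Y} → Guaranteed z p Y → improvedBound ≤ Y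
    improvedBound≤value {p} {Y} Y-ub = *-cancelˡ-≤ (1+-positive 0≤R) (begin
      (1# + R) * (R * (1# + R) ⁻¹)
        ≈⟨ solve 3 (λ S R i → S :* (R :* i) := R :* (S :* i)) refl (1# + R) R ((1# + R) ⁻¹) ⟩
      R * ((1# + R) * (1# + R) ⁻¹)    ≈⟨ *-congˡ (*-inverseʳ _ (≰0⇒≉0 (1+-positive 0≤R))) ⟩
      R * 1#                          ≈⟨ *-identityʳ R ⟩
      R                               ≤⟨ ≰⇒≥ (not-nearly-tight Y-ub) ⟩
      Y * (1# + R)                    ≈⟨ *-comm _ _ ⟩
      (1# + R) * Y                    ∎)

    not-bound : ¬ GameValue (bound r)
    not-bound (ub , _) =
      let L , sv = startValue-exists (λ { (_ , ub′ , _) → improvedBound≤value ub′ }) in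
      improvedBound≰bound (≤-trans (proj₂ sv (λ { (_ , ub′ , _) → improvedBound≤value ub′ })) (ub (z , sv)))

  -- Under `closed`, no edge leaves the set of `z` and its neighbours, so connectedness makes it the
  -- whole graph, and counting it gives `suc d`.
  closed⇒star : ∀ {z} → degree G z ≡ d → (∀ {w x} → z ~ w → w ~ x → x ≡ z) → IsStar G d z
  closed⇒star {z} deg≡d closed =
      ≡.trans (≡.sym (suc-length-filter (z ~?_) id z (irrefl ≡.refl) (λ v → adjacent v))) (≡.cong suc deg≡d)
    , adjacent , edges
    where
    reachable : ∀ {u v} → Star _~_ u v → u ≡ z ⊎ z ~ u → v ≡ z ⊎ z ~ v
    reachable ε         u∈         = u∈
    reachable (u~ ◅ π) (inj₁ ≡.refl) = reachable π (inj₂ u~)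
    reachable (u~ ◅ π) (inj₂ z~u)  = reachable π (inj₁ (closed z~u u~))
    adjacent : ∀ v → v ≢ z → z ~ v
    adjacent v v≢z with reachable (connected z v) (inj₁ ≡.refl)
    ... | inj₁ v≡z = contradiction v≡z v≢z
    ... | inj₂ z~v = z~v
    edges : ∀ u v → u ~ v → u ≡ z ⊎ v ≡ z
    edges u v u~v with u Fin.≟ z
    ... | yes u≡z = inj₁ u≡z
    ... | no u≢z  = inj₂ (closed (adjacent u u≢z) u~v)

  gameValue⇒star : GameValue (bound r) → ∃ (IsStar G d)
  gameValue⇒star value with proj₂ maxDegree
  -- The vertex attaining the maximum degree is the only candidate tested for the centre; the finite
  -- search looks for a walk of length two from it that does not return.
  ... | z , deg≡d with any? (λ w → (z ~? w) ×-dec any? (λ x → (w ~? x) ×-dec ¬? (x Fin.≟ z)))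
  ...   | yes (w , z~w , x , w~x , x≢z) =
            contradiction value (not-bound deg≡d z~w w~x (x≢z ∘ ≡.sym))
  ...   | no none = z , closed⇒star deg≡d closed
    where
    closed : ∀ {w x} → z ~ w → w ~ x → x ≡ z
    closed {w} {x} z~w w~x with x Fin.≟ z
    ... | yes x≡z = x≡z
    ... | no x≢z  = contradiction (w , z~w , x , w~x , x≢z) none

corollary2 : {ℓ : Level} (ℝ : RealField ℓ) {n : ℕ} (G : Graph n) (d : ℕ) →
    Connected G → HasMaxDegree G d →
    (r : RealField.Carrier ℝ) → RealField.IsSqrt ℝ d r →
    let open Game G ℝ in
    (GameValue (bound r) ⇔ (∃ λ z → IsStar G d z))
    × (∀ z → IsStar G d z → ∀ p → CopValue z p (bound r) ⇔ IsStarDistribution r z p)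
    × (∀ z → IsStar G d z → ∀ p → IsStarDistribution r z p → ∀ c → CopValue c p (bound r))
corollary2 ℝ G d connected maxDegree r √d =
    mk⇔ (NonStar.gameValue⇒star ℝ G d connected maxDegree r √d) (λ { (_ , star) → AtStar.gameValue star })
  , (λ z star → AtStar.copValue⇔starDistribution star)
  , (λ z star → AtStar.copValue star)
  where open StarCharacterisation ℝ G d connected r √d
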